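{- Let $p$ be an odd prime, $k,n\ge1$, and let $\mathfrak{B}$ be a $k$-symmetrized quadratic factor of complexity $(d_1,d_2,d_3)$ and rank at least $r$. Then for all $v_1,\ldots,v_{d_1}\in\mathbb{F}_p^k$, $U_1,\ldots,U_{d_2}\in\mathcal{S}_k$ and $V_1,\ldots,V_{d_3}\in\mathcal{S}_k'$, \[\mathbb{P}_{X\in\mathbb{F}_p^{k\times n}}\big[\mathsf{B}(X)=((v_i)_{i\in[d_1]},(U_i)_{i\in[d_2]},(V_i)_{i\in[d_3]})\big]=p^{ -kd_1-\binom{k+1}{2}d_2-\binom{k}{2}d_3}+O(p^{ -r/2}),\] where $X$ is uniformly distributed.
   Context: $\mathcal{S}_k$ (resp. $\mathcal{S}_k'$) is the set of symmetric (resp. skew-symmetric) $k\times k$ matrices over $\mathbb{F}_p$. A $k$-symmetrized quadratic factor $\mathfrak{B}$ is given by vectors $r_1,\ldots,r_{d_1}\in\mathbb{F}_p^n$, symmetric $n\times n$ matrices $M_1,\ldots,M_{d_2}$ and skew-symmetric $n\times n$ matrices $N_1,\ldots,N_{d_3}$ over $\mathbb{F}_p$. It has rank at least $r$ if $r_1,\ldots,r_{d_1}$ are linearly independent and every nontrivial linear combination $\sum_ia_iM_i+\sum_jb_jN_j$ has rank at least $r$. For $X\in\mathbb{F}_p^{k\times n}$, $\mathsf{B}(X)=((Xr_i)_{i\in[d_1]},(XM_iX^\intercal)_{i\in[d_2]},(XN_iX^\intercal)_{i\in[d_3]})$. The $O(\cdot)$ constant does not depend on $n$, on the factor, or on the target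 value. -}

module Defs where

open import Data.Nat as ℕ using (ℕ; zero; suc; NonZero; _∸_)
open import Data.Nat.DivMod using (_mod_)
open import Data.Nat.Properties using (m^n≢0)
open import Data.Nat.Combinatorics using (_C_)
open import Data.Fin as Fin using (Fin; toℕ)
open import Data.Fin.Properties using (all?) renaming (_≟_ to _≟F_)
open import Data.List using (List; []; _∷_; map; concatMap; length; filter; [_])
open import Data.Vec.Functional using () renaming (_∷_ to _∷ᶠ_)
open import Data.Product using (_×_; Σ; ∃; _,_)
open import Data.Empty using (⊥)
open import Relation.Nullary using (¬_; Dec)
open import Relation.Nullary.Decidable using (_×-dec_)
open import Relation.Binary.PropositionalEquality using (_≡_)
open import Data.Integer using (+_)
open import Data.Rational using (ℚ; _/_; _-_; _*_)

module Fp (p : ℕ) .{{nz : NonZero p}} where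

  F : Set
  F = Fin p

  0F : F
  0F = 0 mod p

  _+F_ : F → F → F
  a +F b = (toℕ a ℕ.+ toℕ b) mod p

  _*F_ : F → F → F
  a *F b = (toℕ a ℕ.* toℕ b) mod p

  -F_ : F → F
  -F a = (p ∸ toℕ a) mod p

  sumF : (m : ℕ) → (Fin m → F) → F
  sumF zero    f = 0F
  sumF (suc m) f = f Fin.zero +F sumF m (λ i → f (Fin.suc i))

  Vect : ℕ → Set
  Vect m = Fin m → F

  Mat : ℕ → ℕ → Set
  Mat a b = Fin a → Fin b → F

  Symmetric : {m : ℕ} → Mat m m → Set
  Symmetric A = ∀ i j → A i j ≡ A j i

  SkewSymmetric : {m : ℕ} → Mat m m → Set
  SkewSymmetric A = ∀ i j → A i j ≡ -F (A j i)

  LinIndep : {m n : ℕ} → (Fin m → Vect n) → Set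
  LinIndep {m} {n} v =
    (c : Fin m → F) → (∀ j → sumF m (λ i → c i *F v i j) ≡ 0F) → ∀ i → c i ≡ 0F

  RankAtLeast : {m : ℕ} → ℕ → Mat m m → Set
  RankAtLeast {m} r A = Σ (Fin r → Fin m) λ f → LinIndep (λ i → A (f i))

  record QFactor (n d₁ d₂ d₃ : ℕ) : Set where
    field
      vec   : Fin d₁ → Vect n
      sym   : Fin d₂ → Mat n n
      skew  : Fin d₃ → Mat n n
      sym-symmetric : ∀ i → Symmetric (sym i)
      skew-skew     : ∀ i → SkewSymmetric (skew i)

  linComb : {n d₁ d₂ d₃ : ℕ} → QFactor n d₁ d₂ d₃ → (Fin d₂ → F) → (Fin d₃ → F) → Mat n n
  linComb {n} {d₁} {d₂} {d₃} 𝔅 a b x y =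
    sumF d₂ (λ i → a i *F QFactor.sym 𝔅 i x y) +F sumF d₃ (λ j → b j *F QFactor.skew 𝔅 j x y)

  FactorRankAtLeast : {n d₁ d₂ d₃ : ℕ} → ℕ → QFactor n d₁ d₂ d₃ → Set
  FactorRankAtLeast {n} {d₁} {d₂} {d₃} r 𝔅 =
    LinIndep (QFactor.vec 𝔅) ×
    ((a : Fin d₂ → F) → (b : Fin d₃ → F) →
      ¬ ((∀ i → a i ≡ 0F) × (∀ j → b j ≡ 0F)) → RankAtLeast r (linComb 𝔅 a b))

  matVec : {k n : ℕ} → Mat k n → Vect n → Vect k
  matVec {k} {n} X v i = sumF n (λ j → X i j *F v j)

  quadForm : {k n : ℕ} → Mat k n → Mat n n → Mat k k
  quadForm {k} {n} X M i l = sumF n (λ j → sumF n (λ m → (X i j *F M j m) *F X l m))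

  -- B(X) = ((v_i), (U_i), (V_i)), written out componentwise
  Hits : {k n d₁ d₂ d₃ : ℕ} → QFactor n d₁ d₂ d₃ →
         (Fin d₁ → Vect k) → (Fin d₂ → Mat k k) → (Fin d₃ → Mat k k) → Mat k n → Set
  Hits 𝔅 v U V X =
    (∀ i a → matVec X (QFactor.vec 𝔅 i) a ≡ v i a) ×
    (∀ i a b → quadForm X (QFactor.sym 𝔅 i) a b ≡ U i a b) ×
    (∀ i a b → quadForm X (QFactor.skew 𝔅 i) a b ≡ V i a b)

  hits? : {k n d₁ d₂ d₃ : ℕ} → (𝔅 : QFactor n d₁ d₂ d₃) →
          (v : Fin d₁ → Vect k) → (U : Fin d₂ → Mat k k) → (V : Fin d₃ → Mat k k) →
          (X : Mat k n) → Dec (Hits 𝔅 v U V X)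
  hits? 𝔅 v U V X =
    all? (λ i → all? (λ a → _ ≟F _)) ×-dec
    (all? (λ i → all? (λ a → all? (λ b → _ ≟F _))) ×-dec
     all? (λ i → all? (λ a → all? (λ b → _ ≟F _))))

  allFuns : {A : Set} → (m : ℕ) → List A → List (Fin m → A)
  allFuns zero    xs = [ (λ ()) ]
  allFuns (suc m) xs = concatMap (λ x → map (λ f → x ∷ᶠ f) (allFuns m xs)) xs

  allMats : (k n : ℕ) → List (Mat k n)
  allMats k n = allFuns k (allFuns n (Data.List.allFin p))

  prob : (k n : ℕ) {d₁ d₂ d₃ : ℕ} → QFactor n d₁ d₂ d₃ →
         (Fin d₁ → Vect k) → (Fin d₂ → Mat k k) → (Fin d₃ → Mat k k) → ℚ
  prob k n 𝔅 v U V =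
    _/_ (+ length (filter (hits? 𝔅 v U V) (allMats k n))) (p ℕ.^ (k ℕ.* n)) {{m^n≢0 p (k ℕ.* n)}}

  mainTerm : (k d₁ d₂ d₃ : ℕ) → ℚ
  mainTerm k d₁ d₂ d₃ = _/_ (+ 1) (p ℕ.^ e) {{m^n≢0 p e}}
    where e = k ℕ.* d₁ ℕ.+ ((suc k) C 2) ℕ.* d₂ ℕ.+ (k C 2) ℕ.* d₃

-- Second-moment argument.  The independent coordinates of B(X) form a vector of length
-- m = m₁ + m₂, with m₁ = k d₁ linear ones and m₂ = C(k+1,2) d₂ + C(k,2) d₃ from the upper
-- triangles of the symmetric and skew-symmetric values; let N_t be the number of X with
-- B(X) = t.  Then Σ_t N_t = p^{kn}, and Σ_t N_t² counts the pairs with B(X) = B(X + H).  For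
-- fixed H such a collision forces H rᵢ = 0 and makes X a solution of an affine system whose
-- linear part is X ↦ (X Mᵢ Hᵀ + H Mᵢ Xᵀ, X Nⱼ Hᵀ + H Nⱼ Xᵀ).  If these m₂ functionals are
-- independent there are at most p^{kn-m₂} solutions; a dependency μ ≠ 0 among them puts H in
-- the kernel of a nonzero combination Σ aᵢ Mᵢ + Σ bⱼ Nⱼ, of rank ≥ r, which happens for at most
-- p^{kn-r} matrices H.  Hence Σ_t N_t² · p^m ≤ p^{2kn} (1 + p^{m+m₂-r}), so
-- Σ_t (N_t p^m - p^{kn})² ≤ p^{2kn+2m+m₂-r}, and a single term gives (P - p^{-m})² p^r ≤ p^{m₂}.
module Submission where

open import Defs
open import Algebra.Bundles using (CommutativeRing)
import Algebra.Properties.CommutativeMonoid.Sum as MonoidSum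
import Algebra.Properties.Semiring.Sum as SemiringSum
import Algebra.Solver.Ring.NaturalCoefficients.Default
import Algebra.Structures as Structures
open import Data.Empty using (⊥-elim)
open import Data.Fin as Fin using (Fin; toℕ; _↑ˡ_; _↑ʳ_; splitAt; join; combine; remQuot; punchIn; punchOut)
open import Data.Fin.Properties
  using (all?; ¬∀⟶∃¬; toℕ-injective; toℕ-fromℕ<; toℕ<n; suc-injective; join-splitAt;
         remQuot-combine; combine-remQuot; combine-injective; punchInᵢ≢i; punchOut-punchIn; punchOut-cong)
open import Data.Fin.Permutation using (permutation)
open import Data.Integer as ℤ using (+_)
import Data.Integer.Properties as ℤP
import Data.Integer.Tactic.RingSolver as ℤ-Solver
open import Data.List as List using (List; []; _∷_)
open import Data.Nat as ℕ using (ℕ; zero; suc; NonZero; _≤_; _<_; z≤n; s≤s; _^_; _%_; ∣_-_∣)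
open import Data.Nat.Combinatorics using (_C_; nC1≡n; nCk+nC[k+1]≡[n+1]C[k+1])
open import Data.Nat.DivMod using (_mod_; m<n⇒m%n≡m; n%n≡0; %-distribˡ-+; %-distribˡ-*)
open import Data.Nat.Divisibility using (_∣_; ∣⇒≤; m%n≡0⇒n∣m; n∣m⇒m%n≡0)
open import Data.Nat.Primality using (Prime; euclidsLemma; prime⇒nonTrivial)
import Data.Nat.Properties as ℕP
import Data.Nat.Tactic.RingSolver as ℕ-Solver
open import Data.Nat.Properties using (m^n≢0)
open import Data.Product using (Σ; ∃; _×_; _,_; proj₁; proj₂; uncurry)
open import Data.Rational as ℚ using (ℚ; _/_; _-_; _*_; toℚᵘ) renaming (_≤_ to _≤ℚ_)
import Data.Rational.Properties as ℚP
import Data.Rational.Unnormalised as ℚᵘ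
import Data.Rational.Unnormalised.Properties as ℚᵘP
open import Data.Sum using (_⊎_; inj₁; inj₂; [_,_]′)
open import Data.Vec.Functional using (_++_) renaming (_∷_ to _∷ᶠ_)
open import Data.Vec.Functional.Properties using (lookup-++ˡ; lookup-++ʳ)
open import Relation.Binary.PropositionalEquality hiding ([_])
open import Relation.Nullary using (¬_; Dec; yes; no)
open import Relation.Nullary.Decidable using (_×-dec_; ¬?)

-- Layouts of matrices and triangles as vectors

triangle : ℕ → ℕ
triangle zero    = zero
triangle (suc k) = suc k ℕ.+ triangle k

strictTriangle : ℕ → ℕ
strictTriangle zero    = zero
strictTriangle (suc k) = k ℕ.+ strictTriangle k

triangle≡C : ∀ k → triangle k ≡ suc k C 2
triangle≡C zero    = refl
triangle≡C (suc k) =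
  trans (cong₂ ℕ._+_ (sym (nC1≡n (suc k))) (triangle≡C k)) (nCk+nC[k+1]≡[n+1]C[k+1] (suc k) 1)

strictTriangle≡C : ∀ k → strictTriangle k ≡ k C 2
strictTriangle≡C zero    = refl
strictTriangle≡C (suc k) =
  trans (cong₂ ℕ._+_ (sym (nC1≡n k)) (strictTriangle≡C k)) (nCk+nC[k+1]≡[n+1]C[k+1] k 1)

exponent≡ : ∀ k d₁ d₂ d₃ → k ℕ.* d₁ ℕ.+ (suc k C 2) ℕ.* d₂ ℕ.+ (k C 2) ℕ.* d₃
                          ≡ d₁ ℕ.* k ℕ.+ (d₂ ℕ.* triangle k ℕ.+ d₃ ℕ.* strictTriangle k)
exponent≡ k d₁ d₂ d₃ rewrite sym (triangle≡C k) | sym (strictTriangle≡C k) = regroup k d₁ (triangle k) d₂ (strictTriangle k) d₃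
  where
  regroup : ∀ k d₁ t d₂ s d₃ → k ℕ.* d₁ ℕ.+ t ℕ.* d₂ ℕ.+ s ℕ.* d₃ ≡ d₁ ℕ.* k ℕ.+ (d₂ ℕ.* t ℕ.+ d₃ ℕ.* s)
  regroup = ℕ-Solver.solve-∀

-- Positions (a , b) with a ≤ b, row by row.
upperIndex : ∀ k → Fin (triangle k) → Fin k × Fin k
upperIndex (suc k) t =
  [ (λ b → Fin.zero , b) , (λ t′ → Fin.suc (proj₁ (upperIndex k t′)) , Fin.suc (proj₂ (upperIndex k t′))) ]′
  (splitAt (suc k) t)

-- Positions (a , b) with a < b, row by row.
strictUpperIndex : ∀ k → Fin (strictTriangle k) → Fin k × Fin k
strictUpperIndex (suc k) t =
  [ (λ b → Fin.zero , Fin.suc b) , (λ t′ → Fin.suc (proj₁ (strictUpperIndex k t′)) , Fin.suc (proj₂ (strictUpperIndex k t′))) ]′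
  (splitAt k t)

splitAt-cases : ∀ m n (c : Fin (m ℕ.+ n)) → (∃ λ i → c ≡ i ↑ˡ n) ⊎ (∃ λ j → c ≡ m ↑ʳ j)
splitAt-cases m n c with splitAt m c in eq
... | inj₁ i = inj₁ (i , trans (sym (join-splitAt m n c)) (cong (join m n) eq))
... | inj₂ j = inj₂ (j , trans (sym (join-splitAt m n c)) (cong (join m n) eq))

module _ {A : Set} where

  flatten : ∀ {m n} → (Fin m → Fin n → A) → Fin (m ℕ.* n) → A
  flatten {n = n} f t = uncurry f (remQuot n t)

  unflatten : ∀ {m n} → (Fin (m ℕ.* n) → A) → Fin m → Fin n → A
  unflatten x a j = x (combine a j)

  flatten-combine : ∀ {m n} (f : Fin m → Fin n → A) i j → flatten f (combine i j) ≡ f i j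
  flatten-combine {n = n} f i j = cong (uncurry f) (remQuot-combine i j)

  flatten-pointwise : ∀ {m n} (R : A → A → Set) (f g : Fin m → Fin n → A) → (∀ i j → R (f i j) (g i j)) →
                      ∀ t → R (flatten f t) (flatten g t)
  flatten-pointwise {m} {n} R f g h t = h (proj₁ (remQuot {m} n t)) (proj₂ (remQuot {m} n t))

  upper : ∀ k → (Fin k → Fin k → A) → Fin (triangle k) → A
  upper k M t = uncurry M (upperIndex k t)

  strictUpper : ∀ k → (Fin k → Fin k → A) → Fin (strictTriangle k) → A
  strictUpper k M t = uncurry M (strictUpperIndex k t)

  lower : ∀ {k} → (Fin (suc k) → Fin (suc k) → A) → Fin k → Fin k → A
  lower M a b = M (Fin.suc a) (Fin.suc b)

  upper-++ : ∀ k (M : Fin (suc k) → Fin (suc k) → A) → upper (suc k) M ≗ (M Fin.zero) ++ upper k (lower M)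
  upper-++ k M t with splitAt (suc k) t
  ... | inj₁ _ = refl
  ... | inj₂ _ = refl

  strictUpper-++ : ∀ k (M : Fin (suc k) → Fin (suc k) → A) →
                   strictUpper (suc k) M ≗ (λ b → M Fin.zero (Fin.suc b)) ++ strictUpper k (lower M)
  strictUpper-++ k M t with splitAt k t
  ... | inj₁ _ = refl
  ... | inj₂ _ = refl

  ++-split : ∀ {m n} (R : A → A → Set) (u u′ : Fin m → A) (w w′ : Fin n → A) →
             (∀ t → R ((u ++ w) t) ((u′ ++ w′) t)) → (∀ i → R (u i) (u′ i)) × (∀ j → R (w j) (w′ j))
  ++-split {m} {n} R u u′ w w′ h =
    (λ i → subst₂ R (lookup-++ˡ u w i) (lookup-++ˡ u′ w′ i) (h (i ↑ˡ n))) ,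
    (λ j → subst₂ R (lookup-++ʳ u w j) (lookup-++ʳ u′ w′ j) (h (m ↑ʳ j)))

  ++-pointwise : ∀ {m n} (R : A → A → Set) {u u′ : Fin m → A} {w w′ : Fin n → A} →
                 (∀ i → R (u i) (u′ i)) → (∀ j → R (w j) (w′ j)) → ∀ t → R ((u ++ w) t) ((u′ ++ w′) t)
  ++-pointwise {m} R hu hw t with splitAt m t
  ... | inj₁ i = hu i
  ... | inj₂ j = hw j

  ++-pointwise₃ : ∀ {m n} (R : A → A → A → Set) {u u′ u″ : Fin m → A} {w w′ w″ : Fin n → A} →
                  (∀ i → R (u i) (u′ i) (u″ i)) → (∀ j → R (w j) (w′ j) (w″ j)) →
                  ∀ t → R ((u ++ w) t) ((u′ ++ w′) t) ((u″ ++ w″) t)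
  ++-pointwise₃ {m} R hu hw t with splitAt m t
  ... | inj₁ i = hu i
  ... | inj₂ j = hw j

open MonoidSum ℕP.+-0-commutativeMonoid using (sum; ∑-distrib-+; ∑-comm; sum-permute; sum-cong-≗)

𝟙 : ∀ {a} {A : Set a} → Dec A → ℕ
𝟙 (yes _) = 1
𝟙 (no _)  = 0

module _ {a b} {A : Set a} {B : Set b} where

  𝟙-cong : (dA : Dec A) (dB : Dec B) → (A → B) → (B → A) → 𝟙 dA ≡ 𝟙 dB
  𝟙-cong (yes _) (yes _) f g = refl
  𝟙-cong (yes x) (no ¬y) f g = ⊥-elim (¬y (f x))
  𝟙-cong (no ¬x) (yes y) f g = ⊥-elim (¬x (g y))
  𝟙-cong (no _)  (no _)  f g = refl

  𝟙-mono : (dA : Dec A) (dB : Dec B) → (A → B) → 𝟙 dA ≤ 𝟙 dB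
  𝟙-mono (yes _) (yes _) f = ℕP.≤-refl
  𝟙-mono (yes x) (no ¬y) f = ⊥-elim (¬y (f x))
  𝟙-mono (no _)  _       f = z≤n

module _ {a} {A : Set a} where

  𝟙≤1 : (d : Dec A) → 𝟙 d ≤ 1
  𝟙≤1 (yes _) = s≤s z≤n
  𝟙≤1 (no _)  = z≤n

  𝟙-yes : (d : Dec A) → A → 𝟙 d ≡ 1
  𝟙-yes (yes _) _ = refl
  𝟙-yes (no ¬x) x = ⊥-elim (¬x x)

  𝟙-no : (d : Dec A) → ¬ A → 𝟙 d ≡ 0
  𝟙-no (yes x) ¬x = ⊥-elim (¬x x)
  𝟙-no (no _)  _  = refl

  𝟙-pos : (d : Dec A) → 0 < 𝟙 d → A
  𝟙-pos (yes x) _ = x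

𝟙-× : ∀ {A B C : Set} (dA : Dec A) (dB : Dec B) (dC : Dec C) → (A → B × C) → 𝟙 dA ≤ 𝟙 dB ℕ.* 𝟙 dC
𝟙-× (no _)  dB      dC      f = z≤n
𝟙-× (yes _) (yes _) (yes _) f = ℕP.≤-refl
𝟙-× (yes x) (no ¬y) dC      f = ⊥-elim (¬y (proj₁ (f x)))
𝟙-× (yes x) (yes _) (no ¬z) f = ⊥-elim (¬z (proj₂ (f x)))

sum-mono-≤ : ∀ m {g g′ : Fin m → ℕ} → (∀ i → g i ≤ g′ i) → sum g ≤ sum g′
sum-mono-≤ zero    le = z≤n
sum-mono-≤ (suc m) le = ℕP.+-mono-≤ (le Fin.zero) (sum-mono-≤ m (λ i → le (Fin.suc i)))

sum-*ˡ : ∀ m c (g : Fin m → ℕ) → sum (λ i → c ℕ.* g i) ≡ c ℕ.* sum g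
sum-*ˡ m c g = sym (ℕSum.*-distribˡ-sum c g)
  where module ℕSum = SemiringSum ℕP.+-*-semiring

sum-const : ∀ m c → sum {m} (λ _ → c) ≡ m ℕ.* c
sum-const zero    c = refl
sum-const (suc m) c = cong (c ℕ.+_) (sum-const m c)

≤-sum : ∀ m (g : Fin m → ℕ) i → g i ≤ sum g
≤-sum (suc m) g Fin.zero    = ℕP.m≤m+n _ _
≤-sum (suc m) g (Fin.suc i) = ℕP.≤-trans (≤-sum m _ i) (ℕP.m≤n+m _ _)

sum-pos : ∀ m (g : Fin m → ℕ) → 0 < sum g → ∃ λ i → 0 < g i
sum-pos (suc m) g pos with g Fin.zero in eq
... | suc _ = Fin.zero , subst (0 <_) (sym eq) (s≤s z≤n)
... | zero with sum-pos m (λ i → g (Fin.suc i)) pos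
... | i , q = Fin.suc i , q

sum-𝟙≡ : ∀ m (a : Fin m) (f : Fin m → ℕ) → sum (λ x → 𝟙 (a Fin.≟ x) ℕ.* f x) ≡ f a
sum-𝟙≡ (suc m) Fin.zero f =
  trans (cong₂ ℕ._+_ (ℕP.+-identityʳ (f Fin.zero))
          (trans (sum-cong-≗ (λ x → cong (ℕ._* f (Fin.suc x)) (𝟙-no (Fin.zero Fin.≟ Fin.suc x) λ ()))) (sum-const m 0)))
        (trans (cong (f Fin.zero ℕ.+_) (ℕP.*-zeroʳ m)) (ℕP.+-identityʳ _))
sum-𝟙≡ (suc m) (Fin.suc a) f =
  cong₂ ℕ._+_ (cong (ℕ._* f Fin.zero) (𝟙-no (Fin.suc a Fin.≟ Fin.zero) λ ()))
    (trans (sum-cong-≗ (λ x → cong (ℕ._* f (Fin.suc x)) (𝟙-cong (Fin.suc a Fin.≟ Fin.suc x) (a Fin.≟ x) suc-injective (cong Fin.suc))))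
           (sum-𝟙≡ m a (λ x → f (Fin.suc x))))

sum-𝟙≤1 : ∀ m {P : Fin m → Set} (P? : ∀ x → Dec (P x)) → (∀ x y → P x → P y → x ≡ y) → sum (λ x → 𝟙 (P? x)) ≤ 1
sum-𝟙≤1 m P? unique with sum (λ x → 𝟙 (P? x)) in eq
... | zero = z≤n
... | suc _ with sum-pos m (λ x → 𝟙 (P? x)) (subst (0 <_) (sym eq) (s≤s z≤n))
... | x₀ , q = subst (_≤ 1) eq (ℕP.≤-trans
      (sum-mono-≤ m (λ y → ℕP.≤-trans (𝟙-mono (P? y) (x₀ Fin.≟ y) (unique x₀ y (𝟙-pos (P? x₀) q))) (ℕP.≤-reflexive (sym (ℕP.*-identityʳ _)))))
      (ℕP.≤-reflexive (sum-𝟙≡ m x₀ (λ _ → 1))))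

listSum : ∀ {A : Set} → List A → (A → ℕ) → ℕ
listSum []       g = 0
listSum (x ∷ xs) g = g x ℕ.+ listSum xs g

listSum-++ : ∀ {A : Set} (xs ys : List A) g → listSum (xs List.++ ys) g ≡ listSum xs g ℕ.+ listSum ys g
listSum-++ []       ys g = refl
listSum-++ (x ∷ xs) ys g = trans (cong (g x ℕ.+_) (listSum-++ xs ys g)) (sym (ℕP.+-assoc (g x) _ _))

module _ {A : Set} where

  listSum-map : ∀ {B : Set} (f : A → B) (xs : List A) g → listSum (List.map f xs) g ≡ listSum xs (λ x → g (f x))
  listSum-map f []       g = refl
  listSum-map f (x ∷ xs) g = cong (g (f x) ℕ.+_) (listSum-map f xs g)

  listSum-concatMap : ∀ {B : Set} (f : A → List B) (xs : List A) g →
                      listSum (List.concatMap f xs) g ≡ listSum xs (λ x → listSum (f x) g)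
  listSum-concatMap f []       g = refl
  listSum-concatMap f (x ∷ xs) g = trans (listSum-++ (f x) _ g) (cong (listSum (f x) g ℕ.+_) (listSum-concatMap f xs g))

  listSum-cong : ∀ (xs : List A) {g g′ : A → ℕ} → g ≗ g′ → listSum xs g ≡ listSum xs g′
  listSum-cong []       eq = refl
  listSum-cong (x ∷ xs) eq = cong₂ ℕ._+_ (eq x) (listSum-cong xs eq)

  length-filter≡listSum : ∀ {P : A → Set} (P? : ∀ x → Dec (P x)) (xs : List A) →
                          List.length (List.filter P? xs) ≡ listSum xs (λ x → 𝟙 (P? x))
  length-filter≡listSum P? []       = refl
  length-filter≡listSum P? (x ∷ xs) with P? x
  ... | yes _ = cong suc (length-filter≡listSum P? xs)
  ... | no _  = length-filter≡listSum P? xs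

  listSum-tabulate : ∀ m (f : Fin m → A) g → listSum (List.tabulate f) g ≡ sum (λ i → g (f i))
  listSum-tabulate zero    f g = refl
  listSum-tabulate (suc m) f g = cong (g (f Fin.zero) ℕ.+_) (listSum-tabulate m (λ i → f (Fin.suc i)) g)

-- Arithmetic of the second-moment bound

∣m-n∣²+2mn≡m²+n² : ∀ m n → ∣ m - n ∣ ℕ.* ∣ m - n ∣ ℕ.+ 2 ℕ.* (m ℕ.* n) ≡ m ℕ.* m ℕ.+ n ℕ.* n
∣m-n∣²+2mn≡m²+n² zero    n       = ℕP.+-identityʳ _
∣m-n∣²+2mn≡m²+n² (suc m) zero    = cong (λ z → suc m ℕ.* suc m ℕ.+ 2 ℕ.* z) (ℕP.*-zeroʳ (suc m))
∣m-n∣²+2mn≡m²+n² (suc m) (suc n) = begin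
  ∣ m - n ∣ ℕ.* ∣ m - n ∣ ℕ.+ 2 ℕ.* (suc m ℕ.* suc n)
    ≡⟨ cong (∣ m - n ∣ ℕ.* ∣ m - n ∣ ℕ.+_) (expand m n) ⟩
  ∣ m - n ∣ ℕ.* ∣ m - n ∣ ℕ.+ (2 ℕ.* (m ℕ.* n) ℕ.+ (2 ℕ.* m ℕ.+ 2 ℕ.* n ℕ.+ 2))
    ≡⟨ ℕP.+-assoc (∣ m - n ∣ ℕ.* ∣ m - n ∣) _ _ ⟨
  ∣ m - n ∣ ℕ.* ∣ m - n ∣ ℕ.+ 2 ℕ.* (m ℕ.* n) ℕ.+ (2 ℕ.* m ℕ.+ 2 ℕ.* n ℕ.+ 2)
    ≡⟨ cong (ℕ._+ (2 ℕ.* m ℕ.+ 2 ℕ.* n ℕ.+ 2)) (∣m-n∣²+2mn≡m²+n² m n) ⟩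
  m ℕ.* m ℕ.+ n ℕ.* n ℕ.+ (2 ℕ.* m ℕ.+ 2 ℕ.* n ℕ.+ 2)
    ≡⟨ collect m n ⟩
  suc m ℕ.* suc m ℕ.+ suc n ℕ.* suc n
    ∎
  where
  open ≡-Reasoning
  expand : ∀ m n → 2 ℕ.* (suc m ℕ.* suc n) ≡ 2 ℕ.* (m ℕ.* n) ℕ.+ (2 ℕ.* m ℕ.+ 2 ℕ.* n ℕ.+ 2)
  expand = ℕ-Solver.solve-∀
  collect : ∀ m n → m ℕ.* m ℕ.+ n ℕ.* n ℕ.+ (2 ℕ.* m ℕ.+ 2 ℕ.* n ℕ.+ 2) ≡ suc m ℕ.* suc m ℕ.+ suc n ℕ.* suc n
  collect = ℕ-Solver.solve-∀

-- c counts collisions, L the linear kernel and B the degenerate dual vectors; l = p^{m₁}, q = p^{m₂}, s = p^r.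
collisions-arithmetic : ∀ c L B a q l s → c ℕ.* q ≤ L ℕ.* a ℕ.+ B ℕ.* (a ℕ.* q) → L ℕ.* l ≤ a → B ℕ.* s ≤ q ℕ.* a →
                        c ℕ.* (l ℕ.* q) ℕ.* s ≤ a ℕ.* a ℕ.* s ℕ.+ a ℕ.* a ℕ.* (l ℕ.* q) ℕ.* q
collisions-arithmetic c L B a q l s c≤ L≤ B≤ = begin
  c ℕ.* (l ℕ.* q) ℕ.* s                                ≡⟨ regroup₁ c l q s ⟩
  (c ℕ.* q) ℕ.* (l ℕ.* s)                              ≤⟨ ℕP.*-monoˡ-≤ (l ℕ.* s) c≤ ⟩
  (L ℕ.* a ℕ.+ B ℕ.* (a ℕ.* q)) ℕ.* (l ℕ.* s)          ≡⟨ regroup₂ L a B q l s ⟩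
  (L ℕ.* l) ℕ.* (a ℕ.* s) ℕ.+ (B ℕ.* s) ℕ.* (a ℕ.* q ℕ.* l)
    ≤⟨ ℕP.+-mono-≤ (ℕP.*-monoˡ-≤ (a ℕ.* s) L≤) (ℕP.*-monoˡ-≤ (a ℕ.* q ℕ.* l) B≤) ⟩
  a ℕ.* (a ℕ.* s) ℕ.+ (q ℕ.* a) ℕ.* (a ℕ.* q ℕ.* l)    ≡⟨ regroup₃ a s q l ⟩
  a ℕ.* a ℕ.* s ℕ.+ a ℕ.* a ℕ.* (l ℕ.* q) ℕ.* q        ∎
  where
  open ℕP.≤-Reasoning
  regroup₁ : ∀ c l q s → c ℕ.* (l ℕ.* q) ℕ.* s ≡ (c ℕ.* q) ℕ.* (l ℕ.* s)
  regroup₁ = ℕ-Solver.solve-∀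
  regroup₂ : ∀ L a B q l s → (L ℕ.* a ℕ.+ B ℕ.* (a ℕ.* q)) ℕ.* (l ℕ.* s) ≡ (L ℕ.* l) ℕ.* (a ℕ.* s) ℕ.+ (B ℕ.* s) ℕ.* (a ℕ.* q ℕ.* l)
  regroup₂ = ℕ-Solver.solve-∀
  regroup₃ : ∀ a s q l → a ℕ.* (a ℕ.* s) ℕ.+ (q ℕ.* a) ℕ.* (a ℕ.* q ℕ.* l) ≡ a ℕ.* a ℕ.* s ℕ.+ a ℕ.* a ℕ.* (l ℕ.* q) ℕ.* q
  regroup₃ = ℕ-Solver.solve-∀

-- S = Σ_t (N_t P − Q)², c = Σ_t N_t² over P targets with Σ_t N_t = Q.
second-moment-arithmetic : ∀ S c D P Q q s → S ℕ.+ 2 ℕ.* P ℕ.* Q ℕ.* Q ≡ c ℕ.* (P ℕ.* P) ℕ.+ P ℕ.* (Q ℕ.* Q) →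
                           c ℕ.* P ℕ.* s ≤ Q ℕ.* Q ℕ.* s ℕ.+ Q ℕ.* Q ℕ.* P ℕ.* q → D ≤ S → D ℕ.* s ≤ P ℕ.* P ℕ.* (Q ℕ.* Q) ℕ.* q
second-moment-arithmetic S c D P Q q s S≡ c≤ D≤S = ℕP.≤-trans (ℕP.*-monoˡ-≤ s D≤S) (ℕP.+-cancelʳ-≤ X (S ℕ.* s) _ bound)
  where
  open ℕP.≤-Reasoning
  X = 2 ℕ.* P ℕ.* Q ℕ.* Q ℕ.* s
  bound : S ℕ.* s ℕ.+ X ≤ P ℕ.* P ℕ.* (Q ℕ.* Q) ℕ.* q ℕ.+ X
  bound = begin
    S ℕ.* s ℕ.+ X                                                    ≡⟨ ℕP.*-distribʳ-+ s S _ ⟨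
    (S ℕ.+ 2 ℕ.* P ℕ.* Q ℕ.* Q) ℕ.* s                                 ≡⟨ cong (ℕ._* s) S≡ ⟩
    (c ℕ.* (P ℕ.* P) ℕ.+ P ℕ.* (Q ℕ.* Q)) ℕ.* s                       ≡⟨ regroup₁ c P Q s ⟩
    P ℕ.* (c ℕ.* P ℕ.* s) ℕ.+ P ℕ.* (Q ℕ.* Q) ℕ.* s                   ≤⟨ ℕP.+-monoˡ-≤ _ (ℕP.*-monoʳ-≤ P c≤) ⟩
    P ℕ.* (Q ℕ.* Q ℕ.* s ℕ.+ Q ℕ.* Q ℕ.* P ℕ.* q) ℕ.+ P ℕ.* (Q ℕ.* Q) ℕ.* s ≡⟨ regroup₂ P Q q s ⟩
    P ℕ.* P ℕ.* (Q ℕ.* Q) ℕ.* q ℕ.+ X                                 ∎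
    where
    regroup₁ : ∀ c P Q s → (c ℕ.* (P ℕ.* P) ℕ.+ P ℕ.* (Q ℕ.* Q)) ℕ.* s ≡ P ℕ.* (c ℕ.* P ℕ.* s) ℕ.+ P ℕ.* (Q ℕ.* Q) ℕ.* s
    regroup₁ = ℕ-Solver.solve-∀
    regroup₂ : ∀ P Q q s → P ℕ.* (Q ℕ.* Q ℕ.* s ℕ.+ Q ℕ.* Q ℕ.* P ℕ.* q) ℕ.+ P ℕ.* (Q ℕ.* Q) ℕ.* s
                           ≡ P ℕ.* P ℕ.* (Q ℕ.* Q) ℕ.* q ℕ.+ 2 ℕ.* P ℕ.* Q ℕ.* Q ℕ.* s
    regroup₂ = ℕ-Solver.solve-∀

[m-n]²≡∣m-n∣² : ∀ m n → (+ m ℤ.- + n) ℤ.* (+ m ℤ.- + n) ≡ + (∣ m - n ∣ ℕ.* ∣ m - n ∣)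
[m-n]²≡∣m-n∣² zero    zero    = refl
[m-n]²≡∣m-n∣² zero    (suc n) = trans (ℤP.neg-distribʳ-* (ℤ.- + suc n) (+ suc n))
  (trans (cong ℤ.-_ (ℤP.neg-distribˡ-* (+ suc n) (+ suc n))) (trans (ℤP.neg-involutive _) (sym (ℤP.pos-* (suc n) (suc n)))))
[m-n]²≡∣m-n∣² (suc m) zero    = trans (cong (λ z → z ℤ.* z) (ℤP.+-identityʳ (+ suc m))) (sym (ℤP.pos-* (suc m) (suc m)))
[m-n]²≡∣m-n∣² (suc m) (suc n) = trans (cong (λ z → z ℤ.* z) (drop-suc (+ m) (+ n))) ([m-n]²≡∣m-n∣² m n)
  where
  drop-suc : ∀ a b → (+ 1 ℤ.+ a) ℤ.- (+ 1 ℤ.+ b) ≡ a ℤ.- b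
  drop-suc = ℤ-Solver.solve-∀

-- In ℚᵘ the difference a/b − 1/P has numerator aP − b and denominator bP, so the claim is
-- the hypothesis multiplied out.
squaredDeviationᵘ : ∀ a b P R c .{{_ : NonZero b}} .{{_ : NonZero P}} →
  ∣ a ℕ.* P - b ∣ ℕ.* ∣ a ℕ.* P - b ∣ ℕ.* R ≤ P ℕ.* P ℕ.* (b ℕ.* b) ℕ.* c →
  ((+ a ℚᵘ./ b ℚᵘ.- + 1 ℚᵘ./ P) ℚᵘ.* (+ a ℚᵘ./ b ℚᵘ.- + 1 ℚᵘ./ P)) ℚᵘ.* (+ R ℚᵘ./ 1) ℚᵘ.≤ (+ c ℚᵘ./ 1)
squaredDeviationᵘ a b@(suc _) P@(suc _) R c bound = ℚᵘ.*≤* (subst₂ ℤ._≤_ (sym numerator) (sym denominator) (ℤ.+≤+ bound))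
  where
  G = + a ℤ.* + P ℤ.+ ℤ.- (+ 1) ℤ.* + b
  numerator : (G ℤ.* G ℤ.* + R) ℤ.* + 1 ≡ + (∣ a ℕ.* P - b ∣ ℕ.* ∣ a ℕ.* P - b ∣ ℕ.* R)
  numerator = begin
    (G ℤ.* G ℤ.* + R) ℤ.* + 1                                     ≡⟨ ℤP.*-identityʳ _ ⟩
    G ℤ.* G ℤ.* + R                                               ≡⟨ cong (λ z → z ℤ.* z ℤ.* + R) (normalise (+ a) (+ P) (+ b)) ⟩
    (+ a ℤ.* + P ℤ.- + b) ℤ.* (+ a ℤ.* + P ℤ.- + b) ℤ.* + R       ≡⟨ cong (λ z → (z ℤ.- + b) ℤ.* (z ℤ.- + b) ℤ.* + R) (sym (ℤP.pos-* a P)) ⟩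
    (+ (a ℕ.* P) ℤ.- + b) ℤ.* (+ (a ℕ.* P) ℤ.- + b) ℤ.* + R       ≡⟨ cong (ℤ._* + R) ([m-n]²≡∣m-n∣² (a ℕ.* P) b) ⟩
    + (∣ a ℕ.* P - b ∣ ℕ.* ∣ a ℕ.* P - b ∣) ℤ.* + R               ≡⟨ ℤP.pos-* (∣ a ℕ.* P - b ∣ ℕ.* ∣ a ℕ.* P - b ∣) R ⟨
    + (∣ a ℕ.* P - b ∣ ℕ.* ∣ a ℕ.* P - b ∣ ℕ.* R)                 ∎
    where
    open ≡-Reasoning
    normalise : ∀ a P b → a ℤ.* P ℤ.+ ℤ.- (+ 1) ℤ.* b ≡ a ℤ.* P ℤ.- b
    normalise = ℤ-Solver.solve-∀
  denominator : + c ℤ.* + (b ℕ.* P ℕ.* (b ℕ.* P) ℕ.* 1) ≡ + (P ℕ.* P ℕ.* (b ℕ.* b) ℕ.* c)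
  denominator = trans (sym (ℤP.pos-* c _)) (cong +_ (rearrange c b P))
    where
    rearrange : ∀ c b P → c ℕ.* (b ℕ.* P ℕ.* (b ℕ.* P) ℕ.* 1) ≡ P ℕ.* P ℕ.* (b ℕ.* b) ℕ.* c
    rearrange = ℕ-Solver.solve-∀

toℚᵘ-/ : ∀ i n .{{_ : NonZero n}} → toℚᵘ (i / n) ℚᵘ.≃ (i ℚᵘ./ n)
toℚᵘ-/ i (suc n) = ℚP.toℚᵘ-fromℚᵘ (i ℚᵘ./ suc n)

squaredDeviation : ∀ a b P R c .{{_ : NonZero b}} .{{_ : NonZero P}} →
  ∣ a ℕ.* P - b ∣ ℕ.* ∣ a ℕ.* P - b ∣ ℕ.* R ≤ P ℕ.* P ℕ.* (b ℕ.* b) ℕ.* c →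
  ((+ a / b ℚ.- + 1 / P) ℚ.* (+ a / b ℚ.- + 1 / P)) ℚ.* (+ R / 1) ℚ.≤ (+ c / 1)
squaredDeviation a b P R c bound = ℚP.toℚᵘ-cancel-≤
  (ℚᵘP.≤-respʳ-≃ (ℚᵘP.≃-sym (toℚᵘ-/ (+ c) 1)) (ℚᵘP.≤-respˡ-≃ (ℚᵘP.≃-sym toℚᵘ-lhs) (squaredDeviationᵘ a b P R c bound)))
  where
  x = + a / b
  y = + 1 / P
  toℚᵘ-difference : toℚᵘ (x ℚ.- y) ℚᵘ.≃ (+ a ℚᵘ./ b ℚᵘ.- + 1 ℚᵘ./ P)
  toℚᵘ-difference = ℚᵘP.≃-trans (ℚP.toℚᵘ-homo-+ x (ℚ.- y))
                      (ℚᵘP.+-cong (toℚᵘ-/ (+ a) b) (ℚᵘP.≃-trans (ℚP.toℚᵘ-homo‿- y) (ℚᵘP.-‿cong (toℚᵘ-/ (+ 1) P))))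
  toℚᵘ-lhs : toℚᵘ (((x ℚ.- y) ℚ.* (x ℚ.- y)) ℚ.* (+ R / 1))
             ℚᵘ.≃ ((+ a ℚᵘ./ b ℚᵘ.- + 1 ℚᵘ./ P) ℚᵘ.* (+ a ℚᵘ./ b ℚᵘ.- + 1 ℚᵘ./ P)) ℚᵘ.* (+ R ℚᵘ./ 1)
  toℚᵘ-lhs = ℚᵘP.≃-trans (ℚP.toℚᵘ-homo-* ((x ℚ.- y) ℚ.* (x ℚ.- y)) (+ R / 1))
               (ℚᵘP.*-cong (ℚᵘP.≃-trans (ℚP.toℚᵘ-homo-* (x ℚ.- y) (x ℚ.- y)) (ℚᵘP.*-cong toℚᵘ-difference toℚᵘ-difference))
                           (toℚᵘ-/ (+ R) 1))

-- The prime field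

module FpRing (p : ℕ) .{{_ : NonZero p}} where
  open Fp p

  infixl 6 _⊕_
  infixl 7 _⊗_
  infix  8 ⊝_

  _⊕_ : F → F → F
  _⊕_ = _+F_

  _⊗_ : F → F → F
  _⊗_ = _*F_

  ⊝_ : F → F
  ⊝_ = -F_

  [_] : ℕ → F
  [ m ] = m mod p

  1F : F
  1F = [ 1 ]

  toℕ-[] : ∀ m → toℕ [ m ] ≡ m % p
  toℕ-[] m = toℕ-fromℕ< _

  []-toℕ : ∀ a → [ toℕ a ] ≡ a
  []-toℕ a = toℕ-injective (trans (toℕ-[] (toℕ a)) (m<n⇒m%n≡m (toℕ<n a)))

  toℕ-0F : toℕ 0F ≡ 0
  toℕ-0F = trans (toℕ-[] 0) (m<n⇒m%n≡m (ℕ.>-nonZero⁻¹ p))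

  []-+ : ∀ m n → [ m ] ⊕ [ n ] ≡ [ m ℕ.+ n ]
  []-+ m n = toℕ-injective (begin
    toℕ ([ m ] ⊕ [ n ])            ≡⟨ toℕ-[] _ ⟩
    (toℕ [ m ] ℕ.+ toℕ [ n ]) % p  ≡⟨ cong₂ (λ a b → (a ℕ.+ b) % p) (toℕ-[] m) (toℕ-[] n) ⟩
    (m % p ℕ.+ n % p) % p          ≡⟨ %-distribˡ-+ m n p ⟨
    (m ℕ.+ n) % p                  ≡⟨ toℕ-[] _ ⟨
    toℕ [ m ℕ.+ n ]                ∎)
    where open ≡-Reasoning

  []-* : ∀ m n → [ m ] ⊗ [ n ] ≡ [ m ℕ.* n ]
  []-* m n = toℕ-injective (begin
    toℕ ([ m ] ⊗ [ n ])            ≡⟨ toℕ-[] _ ⟩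
    (toℕ [ m ] ℕ.* toℕ [ n ]) % p  ≡⟨ cong₂ (λ a b → (a ℕ.* b) % p) (toℕ-[] m) (toℕ-[] n) ⟩
    (m % p ℕ.* (n % p)) % p        ≡⟨ %-distribˡ-* m n p ⟨
    (m ℕ.* n) % p                  ≡⟨ toℕ-[] _ ⟨
    toℕ [ m ℕ.* n ]                ∎)
    where open ≡-Reasoning

  -- Each ring law is the image under [_] of the corresponding law of ℕ.
  private
    ⊕-comm : ∀ a b → a ⊕ b ≡ b ⊕ a
    ⊕-comm a b = cong [_] (ℕP.+-comm (toℕ a) (toℕ b))

    ⊗-comm : ∀ a b → a ⊗ b ≡ b ⊗ a
    ⊗-comm a b = cong [_] (ℕP.*-comm (toℕ a) (toℕ b))

    ⊕-assoc : ∀ a b c → (a ⊕ b) ⊕ c ≡ a ⊕ (b ⊕ c)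
    ⊕-assoc a b c = begin
      (a ⊕ b) ⊕ c                        ≡⟨ cong ((a ⊕ b) ⊕_) (sym ([]-toℕ c)) ⟩
      (a ⊕ b) ⊕ [ toℕ c ]                ≡⟨ []-+ _ _ ⟩
      [ toℕ a ℕ.+ toℕ b ℕ.+ toℕ c ]      ≡⟨ cong [_] (ℕP.+-assoc (toℕ a) _ _) ⟩
      [ toℕ a ℕ.+ (toℕ b ℕ.+ toℕ c) ]    ≡⟨ []-+ _ _ ⟨
      [ toℕ a ] ⊕ (b ⊕ c)                ≡⟨ cong (_⊕ (b ⊕ c)) ([]-toℕ a) ⟩
      a ⊕ (b ⊕ c)                        ∎
      where open ≡-Reasoning

    ⊗-assoc : ∀ a b c → (a ⊗ b) ⊗ c ≡ a ⊗ (b ⊗ c)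
    ⊗-assoc a b c = begin
      (a ⊗ b) ⊗ c                        ≡⟨ cong ((a ⊗ b) ⊗_) (sym ([]-toℕ c)) ⟩
      (a ⊗ b) ⊗ [ toℕ c ]                ≡⟨ []-* _ _ ⟩
      [ toℕ a ℕ.* toℕ b ℕ.* toℕ c ]      ≡⟨ cong [_] (ℕP.*-assoc (toℕ a) _ _) ⟩
      [ toℕ a ℕ.* (toℕ b ℕ.* toℕ c) ]    ≡⟨ []-* _ _ ⟨
      [ toℕ a ] ⊗ (b ⊗ c)                ≡⟨ cong (_⊗ (b ⊗ c)) ([]-toℕ a) ⟩
      a ⊗ (b ⊗ c)                        ∎
      where open ≡-Reasoning

    ⊗-distribˡ-⊕ : ∀ a b c → a ⊗ (b ⊕ c) ≡ a ⊗ b ⊕ a ⊗ c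
    ⊗-distribˡ-⊕ a b c = begin
      a ⊗ (b ⊕ c)                               ≡⟨ cong (_⊗ (b ⊕ c)) (sym ([]-toℕ a)) ⟩
      [ toℕ a ] ⊗ (b ⊕ c)                       ≡⟨ []-* _ _ ⟩
      [ toℕ a ℕ.* (toℕ b ℕ.+ toℕ c) ]           ≡⟨ cong [_] (ℕP.*-distribˡ-+ (toℕ a) _ _) ⟩
      [ toℕ a ℕ.* toℕ b ℕ.+ toℕ a ℕ.* toℕ c ]   ≡⟨ []-+ _ _ ⟨
      a ⊗ b ⊕ a ⊗ c                             ∎
      where open ≡-Reasoning

    ⊕-identityˡ : ∀ a → 0F ⊕ a ≡ a
    ⊕-identityˡ a = trans (cong (0F ⊕_) (sym ([]-toℕ a))) (trans ([]-+ 0 _) ([]-toℕ a))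

    ⊗-identityˡ : ∀ a → 1F ⊗ a ≡ a
    ⊗-identityˡ a =
      trans (cong (1F ⊗_) (sym ([]-toℕ a))) (trans ([]-* 1 _) (trans (cong [_] (ℕP.*-identityˡ _)) ([]-toℕ a)))

    ⊝-inverseˡ : ∀ a → ⊝ a ⊕ a ≡ 0F
    ⊝-inverseˡ a = begin
      ⊝ a ⊕ a                   ≡⟨ cong (⊝ a ⊕_) (sym ([]-toℕ a)) ⟩
      ⊝ a ⊕ [ toℕ a ]           ≡⟨ []-+ _ _ ⟩
      [ p ℕ.∸ toℕ a ℕ.+ toℕ a ] ≡⟨ cong [_] (ℕP.m∸n+n≡m (ℕP.<⇒≤ (toℕ<n a))) ⟩
      [ p ]                     ≡⟨ toℕ-injective (trans (toℕ-[] p) (trans (n%n≡0 p) (sym toℕ-0F))) ⟩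
      0F                        ∎
      where open ≡-Reasoning

  isCommutativeRing : Structures.IsCommutativeRing _≡_ _⊕_ _⊗_ ⊝_ 0F 1F
  isCommutativeRing = record
    { isRing = record
      { +-isAbelianGroup = record
        { isGroup = record
          { isMonoid = record
            { isSemigroup = record
              { isMagma = record { isEquivalence = isEquivalence ; ∙-cong = cong₂ _⊕_ }
              ; assoc = ⊕-assoc }
            ; identity = ⊕-identityˡ , λ a → trans (⊕-comm a 0F) (⊕-identityˡ a) }
          ; inverse = ⊝-inverseˡ , λ a → trans (⊕-comm a (⊝ a)) (⊝-inverseˡ a)
          ; ⁻¹-cong = cong ⊝_ }
        ; comm = ⊕-comm }
      ; *-cong = cong₂ _⊗_
      ; *-assoc = ⊗-assoc
      ; *-identity = ⊗-identityˡ , λ a → trans (⊗-comm a 1F) (⊗-identityˡ a)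
      ; distrib = ⊗-distribˡ-⊕ , λ a b c →
          trans (⊗-comm (b ⊕ c) a) (trans (⊗-distribˡ-⊕ a b c) (cong₂ _⊕_ (⊗-comm a b) (⊗-comm a c)))
      }
    ; *-comm = ⊗-comm }

  commutativeRing : CommutativeRing _ _
  commutativeRing = record { isCommutativeRing = isCommutativeRing }

  module FpSolver = Algebra.Solver.Ring.NaturalCoefficients.Default (CommutativeRing.commutativeSemiring commutativeRing)

  open CommutativeRing commutativeRing public
    using (+-comm; +-assoc; +-identityˡ; +-identityʳ; -‿inverseˡ; -‿inverseʳ;
           *-comm; *-assoc; *-identityˡ; *-identityʳ; distribˡ; distribʳ; zeroˡ; zeroʳ)
  open import Algebra.Properties.Ring (CommutativeRing.ring commutativeRing) public
    using (-‿distribˡ-*; -‿distribʳ-*; -‿involutive; -0#≈0#; -‿+-comm; +-cancelʳ;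
           +-identityʳ-unique; +-inverseʳ-unique; x∙y⁻¹≈ε⇒x≈y)

  private module Sum = SemiringSum (CommutativeRing.semiring commutativeRing)

  sumF≡sum : ∀ m (f : Fin m → F) → sumF m f ≡ Sum.sum f
  sumF≡sum zero    f = refl
  sumF≡sum (suc m) f = cong (f Fin.zero ⊕_) (sumF≡sum m _)

  sumF-cong : ∀ m {f g : Fin m → F} → f ≗ g → sumF m f ≡ sumF m g
  sumF-cong zero    eq = refl
  sumF-cong (suc m) eq = cong₂ _⊕_ (eq Fin.zero) (sumF-cong m (λ i → eq (Fin.suc i)))

  sumF-+ : ∀ m (f g : Fin m → F) → sumF m (λ i → f i ⊕ g i) ≡ sumF m f ⊕ sumF m g
  sumF-+ m f g =
    trans (sumF≡sum m _) (trans (Sum.∑-distrib-+ f g) (sym (cong₂ _⊕_ (sumF≡sum m f) (sumF≡sum m g))))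

  sumF-*ˡ : ∀ m c (f : Fin m → F) → sumF m (λ i → c ⊗ f i) ≡ c ⊗ sumF m f
  sumF-*ˡ m c f = trans (sumF≡sum m _) (trans (sym (Sum.*-distribˡ-sum c f)) (cong (c ⊗_) (sym (sumF≡sum m f))))

  sumF-*ʳ : ∀ m c (f : Fin m → F) → sumF m (λ i → f i ⊗ c) ≡ sumF m f ⊗ c
  sumF-*ʳ m c f = trans (sumF-cong m (λ i → *-comm (f i) c)) (trans (sumF-*ˡ m c f) (*-comm c _))

  sumF-0 : ∀ m → sumF m (λ _ → 0F) ≡ 0F
  sumF-0 zero    = refl
  sumF-0 (suc m) = trans (cong (0F ⊕_) (sumF-0 m)) (+-identityˡ 0F)

  sumF-⊝ : ∀ m (f : Fin m → F) → sumF m (λ i → ⊝ f i) ≡ ⊝ sumF m f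
  sumF-⊝ zero    f = sym -0#≈0#
  sumF-⊝ (suc m) f = trans (cong (⊝ f Fin.zero ⊕_) (sumF-⊝ m _)) (-‿+-comm (f Fin.zero) _)

  sumF-remove : ∀ m (j : Fin (suc m)) (f : Fin (suc m) → F) → sumF (suc m) f ≡ f j ⊕ sumF m (λ i → f (punchIn j i))
  sumF-remove m j f = trans (sumF≡sum (suc m) f) (trans (Sum.sum-remove {i = j} f) (cong (f j ⊕_) (sym (sumF≡sum m _))))

  sumF-comm : ∀ m n (f : Fin m → Fin n → F) → sumF m (λ i → sumF n (f i)) ≡ sumF n (λ j → sumF m (λ i → f i j))
  sumF-comm m n f = begin
    sumF m (λ i → sumF n (f i))          ≡⟨ sumF≡sum m _ ⟩
    Sum.sum (λ i → sumF n (f i))         ≡⟨ Sum.sum-cong-≗ (λ i → sumF≡sum n (f i)) ⟩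
    Sum.sum (λ i → Sum.sum (f i))        ≡⟨ Sum.∑-comm f ⟩
    Sum.sum (λ j → Sum.sum (λ i → f i j)) ≡⟨ Sum.sum-cong-≗ (λ j → sumF≡sum m (λ i → f i j)) ⟨
    Sum.sum (λ j → sumF m (λ i → f i j))  ≡⟨ sumF≡sum n _ ⟨
    sumF n (λ j → sumF m (λ i → f i j))  ∎
    where open ≡-Reasoning

  sumF-splitAt : ∀ m n (f : Fin (m ℕ.+ n) → F) → sumF (m ℕ.+ n) f ≡ sumF m (λ i → f (i ↑ˡ n)) ⊕ sumF n (λ j → f (m ↑ʳ j))
  sumF-splitAt zero    n f = sym (+-identityˡ _)
  sumF-splitAt (suc m) n f =
    trans (cong (f Fin.zero ⊕_) (sumF-splitAt m n (λ i → f (Fin.suc i)))) (sym (+-assoc (f Fin.zero) _ _))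

  sumF-combine : ∀ m n (f : Fin (m ℕ.* n) → F) → sumF (m ℕ.* n) f ≡ sumF m (λ i → sumF n (λ j → f (combine i j)))
  sumF-combine zero    n f = refl
  sumF-combine (suc m) n f =
    trans (sumF-splitAt n (m ℕ.* n) f) (cong (sumF n (λ j → f (j ↑ˡ (m ℕ.* n))) ⊕_) (sumF-combine m n (λ t → f (n ↑ʳ t))))

  sumF₂-+ : ∀ m n (f g : Fin m → Fin n → F) →
            sumF m (λ i → sumF n (λ j → f i j ⊕ g i j)) ≡ sumF m (λ i → sumF n (f i)) ⊕ sumF m (λ i → sumF n (g i))
  sumF₂-+ m n f g = trans (sumF-cong m (λ i → sumF-+ n (f i) (g i))) (sumF-+ m _ _)

  sumF₂-*ˡ : ∀ m n c (f : Fin m → Fin n → F) → sumF m (λ i → sumF n (λ j → c ⊗ f i j)) ≡ c ⊗ sumF m (λ i → sumF n (f i))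
  sumF₂-*ˡ m n c f = trans (sumF-cong m (λ i → sumF-*ˡ n c (f i))) (sumF-*ˡ m c _)

  dot : ∀ {m} → Vect m → Vect m → F
  dot {m} μ u = sumF m (λ c → μ c ⊗ u c)

  dot-++ : ∀ m n (μ : Vect (m ℕ.+ n)) (u : Vect m) (w : Vect n) →
           dot μ (u ++ w) ≡ dot (λ i → μ (i ↑ˡ n)) u ⊕ dot (λ j → μ (m ↑ʳ j)) w
  dot-++ m n μ u w = trans (sumF-splitAt m n _)
    (cong₂ _⊕_ (sumF-cong m (λ i → cong (μ (i ↑ˡ n) ⊗_) (lookup-++ˡ u w i)))
               (sumF-cong n (λ j → cong (μ (m ↑ʳ j) ⊗_) (lookup-++ʳ u w j))))

  dot-flatten : ∀ m n (μ : Vect (m ℕ.* n)) (f : Fin m → Fin n → F) →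
                dot μ (flatten f) ≡ sumF m (λ i → sumF n (λ j → μ (combine i j) ⊗ f i j))
  dot-flatten m n μ f =
    trans (sumF-combine m n _) (sumF-cong m (λ i → sumF-cong n (λ j → cong (μ (combine i j) ⊗_) (flatten-combine f i j))))

  basis : ∀ {N} → Fin N → Vect N
  basis t₀ t with t Fin.≟ t₀
  ... | yes _ = 1F
  ... | no _  = 0F

  sumF-basis : ∀ N (t₀ : Fin N) (f : Fin N → F) → sumF N (λ t → basis t₀ t ⊗ f t) ≡ f t₀
  sumF-basis (suc N) Fin.zero f =
    trans (cong₂ _⊕_ (*-identityˡ (f Fin.zero)) (trans (sumF-cong N (λ t → trans (cong (_⊗ f (Fin.suc t)) (basis-suc t)) (zeroˡ _))) (sumF-0 N)))
          (+-identityʳ _)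
    where
    basis-suc : ∀ t → basis {suc N} Fin.zero (Fin.suc t) ≡ 0F
    basis-suc t with Fin.suc t Fin.≟ Fin.zero
    ... | no _ = refl
  sumF-basis (suc N) (Fin.suc t₀) f =
    trans (cong₂ _⊕_ (zeroˡ (f Fin.zero)) (trans (sumF-cong N (λ t → cong (_⊗ f (Fin.suc t)) (basis-suc t))) (sumF-basis N t₀ _)))
          (+-identityˡ _)
    where
    basis-suc : ∀ t → basis {suc N} (Fin.suc t₀) (Fin.suc t) ≡ basis t₀ t
    basis-suc t with Fin.suc t Fin.≟ Fin.suc t₀ | t Fin.≟ t₀
    ... | yes _ | yes _  = refl
    ... | no _  | no _   = refl
    ... | yes e | no ne  = ⊥-elim (ne (suc-injective e))
    ... | no ne | yes e  = ⊥-elim (ne (cong Fin.suc e))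

  basis-combine : ∀ {k n} (a₀ : Fin k) (j₀ : Fin n) a j → basis (combine a₀ j₀) (combine a j) ≡ basis a₀ a ⊗ basis j₀ j
  basis-combine a₀ j₀ a j with combine a j Fin.≟ combine a₀ j₀ | a Fin.≟ a₀ | j Fin.≟ j₀
  ... | yes e  | yes _    | yes _  = sym (*-identityˡ 1F)
  ... | yes e  | no ne    | _      = ⊥-elim (ne (proj₁ (combine-injective a j a₀ j₀ e)))
  ... | yes e  | yes _    | no ne  = ⊥-elim (ne (proj₂ (combine-injective a j a₀ j₀ e)))
  ... | no ne  | yes refl | yes refl = ⊥-elim (ne refl)
  ... | no _   | no _     | yes _  = sym (zeroˡ 1F)
  ... | no _   | no _     | no _   = sym (zeroˡ 0F)
  ... | no _   | yes _    | no _   = sym (zeroʳ 1F)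

  sumF₂-basis : ∀ k n (a₀ : Fin k) (j₀ : Fin n) (f : Fin k → Fin n → F) →
                sumF k (λ a → sumF n (λ j → basis (combine a₀ j₀) (combine a j) ⊗ f a j)) ≡ f a₀ j₀
  sumF₂-basis k n a₀ j₀ f = trans
    (sumF-cong k (λ a → trans
      (sumF-cong n (λ j → trans (cong (_⊗ f a j) (basis-combine a₀ j₀ a j)) (*-assoc (basis a₀ a) (basis j₀ j) (f a j))))
      (sumF-*ˡ n (basis a₀ a) _)))
    (trans (sumF-basis k a₀ _) (sumF-basis n j₀ (f a₀)))

  0V : ∀ {N} → Vect N
  0V _ = 0F

  _+V_ : ∀ {N} → Vect N → Vect N → Vect N
  (u +V w) i = u i ⊕ w i

  _·V_ : ∀ {N} → F → Vect N → Vect N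
  (c ·V u) i = c ⊗ u i

module FpField (p : ℕ) .{{_ : NonZero p}} (p-prime : Prime p) where
  open Fp p
  open FpRing p

  open FpSolver using (solve; _:=_; _:+_; _:*_)

  [m]≡0⇒p∣m : ∀ m → [ m ] ≡ 0F → p ∣ m
  [m]≡0⇒p∣m m eq = m%n≡0⇒n∣m _ _ (trans (sym (toℕ-[] m)) (trans (cong toℕ eq) toℕ-0F))

  p∣toℕ⇒≡0 : ∀ a → p ∣ toℕ a → a ≡ 0F
  p∣toℕ⇒≡0 a p∣a = toℕ-injective (trans (sym (m<n⇒m%n≡m (toℕ<n a))) (trans (n∣m⇒m%n≡0 _ _ p∣a) (sym toℕ-0F)))

  x*y≡0⇒x≡0∨y≡0 : ∀ x y → x ⊗ y ≡ 0F → x ≡ 0F ⊎ y ≡ 0F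
  x*y≡0⇒x≡0∨y≡0 x y eq with euclidsLemma (toℕ x) (toℕ y) p-prime ([m]≡0⇒p∣m _ eq)
  ... | inj₁ p∣x = inj₁ (p∣toℕ⇒≡0 x p∣x)
  ... | inj₂ p∣y = inj₂ (p∣toℕ⇒≡0 y p∣y)

  x*y≡0⇒x≡0 : ∀ x y → x ⊗ y ≡ 0F → y ≢ 0F → x ≡ 0F
  x*y≡0⇒x≡0 x y eq y≢0 with x*y≡0⇒x≡0∨y≡0 x y eq
  ... | inj₁ x≡0 = x≡0
  ... | inj₂ y≡0 = ⊥-elim (y≢0 y≡0)

  1<p : 1 < p
  1<p = ℕ.nonTrivial⇒n>1 p {{prime⇒nonTrivial p-prime}}

  1≢0 : 1F ≢ 0F
  1≢0 eq = ℕP.<⇒≱ 1<p (∣⇒≤ ([m]≡0⇒p∣m 1 eq))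

  x+x≡0⇒x≡0 : p ≢ 2 → ∀ x → x ⊕ x ≡ 0F → x ≡ 0F
  x+x≡0⇒x≡0 p≢2 x eq = x*y≡0⇒x≡0 x [ 2 ] (trans x*2≡x+x eq) 2≢0
    where
    2≢0 : [ 2 ] ≢ 0F
    2≢0 eq′ = p≢2 (ℕP.≤-antisym (∣⇒≤ ([m]≡0⇒p∣m 2 eq′)) 1<p)
    x*2≡x+x : x ⊗ [ 2 ] ≡ x ⊕ x
    x*2≡x+x = begin
      x ⊗ [ 2 ]             ≡⟨ cong (x ⊗_) ([]-+ 1 1) ⟨
      x ⊗ (1F ⊕ 1F)         ≡⟨ solve 2 (λ x u → x :* (u :+ u) := x :* u :+ x :* u) refl x 1F ⟩
      x ⊗ 1F ⊕ x ⊗ 1F       ≡⟨ cong₂ _⊕_ (*-identityʳ x) (*-identityʳ x) ⟩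
      x ⊕ x                 ∎
      where open ≡-Reasoning

-- Sums over F_p^N

module Counting (p : ℕ) .{{_ : NonZero p}} where
  open Fp p
  open FpRing p

  sum-translate : ∀ c (g : F → ℕ) → sum (λ x → g (c ⊕ x)) ≡ sum g
  sum-translate c g = sym (sum-permute g (permutation (c ⊕_) (⊝ c ⊕_) cancel cancel′))
    where
    cancel : ∀ y → c ⊕ (⊝ c ⊕ y) ≡ y
    cancel y = trans (sym (+-assoc c (⊝ c) y)) (trans (cong (_⊕ y) (-‿inverseʳ c)) (+-identityˡ y))
    cancel′ : ∀ y → ⊝ c ⊕ (c ⊕ y) ≡ y
    cancel′ y = trans (sym (+-assoc (⊝ c) c y)) (trans (cong (_⊕ y) (-‿inverseˡ c)) (+-identityˡ y))

  _≟V_ : ∀ {N} (u w : Vect N) → Dec (u ≗ w)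
  u ≟V w = all? (λ i → u i Fin.≟ w i)

  Extensional : ∀ {N} → (Vect N → ℕ) → Set
  Extensional g = ∀ {h h′} → h ≗ h′ → g h ≡ g h′

  vsum : ∀ N → (Vect N → ℕ) → ℕ
  vsum zero    g = g (λ ())
  vsum (suc N) g = sum (λ x → vsum N (λ h → g (x ∷ᶠ h)))

  vsum-cong : ∀ N {g g′ : Vect N → ℕ} → (∀ h → g h ≡ g′ h) → vsum N g ≡ vsum N g′
  vsum-cong zero    eq = eq _
  vsum-cong (suc N) eq = sum-cong-≗ {p} (λ x → vsum-cong N (λ h → eq _))

  vsum-mono-≤ : ∀ N {g g′ : Vect N → ℕ} → (∀ h → g h ≤ g′ h) → vsum N g ≤ vsum N g′
  vsum-mono-≤ zero    le = le _
  vsum-mono-≤ (suc N) le = sum-mono-≤ p (λ x → vsum-mono-≤ N (λ h → le _))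

  vsum-distrib-+ : ∀ N (g g′ : Vect N → ℕ) → vsum N (λ h → g h ℕ.+ g′ h) ≡ vsum N g ℕ.+ vsum N g′
  vsum-distrib-+ zero    g g′ = refl
  vsum-distrib-+ (suc N) g g′ = trans (sum-cong-≗ {p} (λ x → vsum-distrib-+ N _ _)) (∑-distrib-+ (λ x → vsum N (λ h → g (x ∷ᶠ h))) _)

  vsum-*ˡ : ∀ N c (g : Vect N → ℕ) → vsum N (λ h → c ℕ.* g h) ≡ c ℕ.* vsum N g
  vsum-*ˡ zero    c g = refl
  vsum-*ˡ (suc N) c g = trans (sum-cong-≗ {p} (λ x → vsum-*ˡ N c _)) (sum-*ˡ p c _)

  vsum-*ʳ : ∀ N c (g : Vect N → ℕ) → vsum N (λ h → g h ℕ.* c) ≡ vsum N g ℕ.* c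
  vsum-*ʳ N c g = trans (vsum-cong N (λ h → ℕP.*-comm (g h) c)) (trans (vsum-*ˡ N c g) (ℕP.*-comm c _))

  vsum-const : ∀ N c → vsum N (λ _ → c) ≡ p ^ N ℕ.* c
  vsum-const zero    c = sym (ℕP.+-identityʳ c)
  vsum-const (suc N) c = trans (sum-cong-≗ {p} (λ x → vsum-const N c)) (trans (sum-const p _) (sym (ℕP.*-assoc p _ c)))

  vsum-sum : ∀ N m (g : Vect N → Fin m → ℕ) → vsum N (λ h → sum (g h)) ≡ sum (λ i → vsum N (λ h → g h i))
  vsum-sum zero    m g = refl
  vsum-sum (suc N) m g = trans (sum-cong-≗ {p} (λ x → vsum-sum N m _)) (∑-comm (λ x i → vsum N (λ h → g (x ∷ᶠ h) i)))

  vsum-comm : ∀ N M (g : Vect N → Vect M → ℕ) → vsum N (λ h → vsum M (g h)) ≡ vsum M (λ w → vsum N (λ h → g h w))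
  vsum-comm N zero    g = refl
  vsum-comm N (suc M) g = trans (vsum-sum N p _) (sum-cong-≗ {p} (λ x → vsum-comm N M _))

  head∷tail : ∀ {N} (h : Vect (suc N)) → h ≗ h Fin.zero ∷ᶠ (λ i → h (Fin.suc i))
  head∷tail h Fin.zero    = refl
  head∷tail h (Fin.suc i) = refl

  Extensional-∷ : ∀ {N} {g : Vect (suc N) → ℕ} → Extensional g → ∀ x → Extensional (λ h → g (x ∷ᶠ h))
  Extensional-∷ e x eq = e λ { Fin.zero → refl ; (Fin.suc i) → eq i }

  ≤-vsum : ∀ N {g : Vect N → ℕ} → Extensional g → ∀ h → g h ≤ vsum N g
  ≤-vsum zero    e h = ℕP.≤-reflexive (e λ ())
  ≤-vsum (suc N) e h = ℕP.≤-trans (ℕP.≤-reflexive (e (head∷tail h)))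
    (ℕP.≤-trans (≤-vsum N (Extensional-∷ e (h Fin.zero)) (λ i → h (Fin.suc i))) (≤-sum p _ (h Fin.zero)))

  vsum-pos : ∀ N (g : Vect N → ℕ) → 0 < vsum N g → ∃ λ h → 0 < g h
  vsum-pos zero    g pos = _ , pos
  vsum-pos (suc N) g pos with sum-pos p _ pos
  ... | x , q with vsum-pos N _ q
  ... | h , r = (x ∷ᶠ h) , r

  vsum-translate : ∀ N {g : Vect N → ℕ} → Extensional g → ∀ c → vsum N (λ h → g (c +V h)) ≡ vsum N g
  vsum-translate zero    e c = e λ ()
  vsum-translate (suc N) {g} e c = begin
    sum (λ x → vsum N (λ h → g (c +V (x ∷ᶠ h))))
      ≡⟨ sum-cong-≗ {p} (λ x → vsum-cong N (λ h → e λ { Fin.zero → refl ; (Fin.suc i) → refl })) ⟩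
    sum (λ x → vsum N (λ h → g ((c Fin.zero ⊕ x) ∷ᶠ (c′ +V h))))
      ≡⟨ sum-cong-≗ {p} (λ x → vsum-translate N (Extensional-∷ e (c Fin.zero ⊕ x)) c′) ⟩
    sum (λ x → vsum N (λ h → g ((c Fin.zero ⊕ x) ∷ᶠ h)))
      ≡⟨ sum-translate (c Fin.zero) (λ y → vsum N (λ h → g (y ∷ᶠ h))) ⟩
    sum (λ y → vsum N (λ h → g (y ∷ᶠ h)))
      ∎
    where
    open ≡-Reasoning
    c′ : Vect N
    c′ i = c (Fin.suc i)

  vsum-𝟙≡ : ∀ N (u : Vect N) {g : Vect N → ℕ} → Extensional g → vsum N (λ t → 𝟙 (u ≟V t) ℕ.* g t) ≡ g u
  vsum-𝟙≡ zero    u {g} e = trans (cong (ℕ._* g (λ ())) (𝟙-yes (u ≟V (λ ())) λ ())) (trans (ℕP.+-identityʳ _) (e λ ()))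
  vsum-𝟙≡ (suc N) u {g} e = begin
    sum (λ x → vsum N (λ h → 𝟙 (u ≟V (x ∷ᶠ h)) ℕ.* g (x ∷ᶠ h)))
      ≡⟨ sum-cong-≗ {p} (λ x → vsum-cong N (λ h → cong (ℕ._* g (x ∷ᶠ h)) (𝟙-∷ x h))) ⟩
    sum (λ x → vsum N (λ h → 𝟙 (u Fin.zero Fin.≟ x) ℕ.* 𝟙 (u′ ≟V h) ℕ.* g (x ∷ᶠ h)))
      ≡⟨ sum-cong-≗ {p} (λ x → trans (vsum-cong N (λ h → ℕP.*-assoc (𝟙 (u Fin.zero Fin.≟ x)) _ _))
                                       (vsum-*ˡ N (𝟙 (u Fin.zero Fin.≟ x)) (λ h → 𝟙 (u′ ≟V h) ℕ.* g (x ∷ᶠ h)))) ⟩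
    sum (λ x → 𝟙 (u Fin.zero Fin.≟ x) ℕ.* vsum N (λ h → 𝟙 (u′ ≟V h) ℕ.* g (x ∷ᶠ h)))
      ≡⟨ sum-cong-≗ {p} (λ x → cong (𝟙 (u Fin.zero Fin.≟ x) ℕ.*_) (vsum-𝟙≡ N u′ (Extensional-∷ e x))) ⟩
    sum (λ x → 𝟙 (u Fin.zero Fin.≟ x) ℕ.* g (x ∷ᶠ u′))
      ≡⟨ sum-𝟙≡ p (u Fin.zero) (λ x → g (x ∷ᶠ u′)) ⟩
    g (u Fin.zero ∷ᶠ u′)
      ≡⟨ e (λ i → sym (head∷tail u i)) ⟩
    g u
      ∎
    where
    open ≡-Reasoning
    u′ : Vect N
    u′ i = u (Fin.suc i)
    𝟙-∷ : ∀ x h → 𝟙 (u ≟V (x ∷ᶠ h)) ≡ 𝟙 (u Fin.zero Fin.≟ x) ℕ.* 𝟙 (u′ ≟V h)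
    𝟙-∷ x h with u Fin.zero Fin.≟ x | u′ ≟V h | u ≟V (x ∷ᶠ h)
    ... | yes _  | yes _  | yes _  = refl
    ... | yes x≡ | yes h≡ | no ¬≡  = ⊥-elim (¬≡ λ { Fin.zero → x≡ ; (Fin.suc i) → h≡ i })
    ... | yes _  | no ¬h≡ | yes ≡′ = ⊥-elim (¬h≡ (λ i → ≡′ (Fin.suc i)))
    ... | yes _  | no _   | no _   = refl
    ... | no ¬x≡ | _      | yes ≡′ = ⊥-elim (¬x≡ (≡′ Fin.zero))
    ... | no _   | _      | no _   = refl

  𝟙≟V-extensional : ∀ {N} (u : Vect N) → Extensional (λ t → 𝟙 (u ≟V t))
  𝟙≟V-extensional u eq = 𝟙-cong (u ≟V _) (u ≟V _) (λ q i → trans (q i) (eq i)) (λ q i → trans (q i) (sym (eq i)))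

  vsum-𝟙≟V : ∀ N (u : Vect N) → vsum N (λ t → 𝟙 (u ≟V t)) ≡ 1
  vsum-𝟙≟V N u = trans (vsum-cong N (λ t → sym (ℕP.*-identityʳ _))) (vsum-𝟙≡ N u {λ _ → 1} (λ _ → refl))

  ∀V? : ∀ N {P : Vect N → Set} → (∀ h → Dec (P h)) → (∀ {h h′} → h ≗ h′ → P h → P h′) → Dec (∀ h → P h)
  ∀V? zero    P? resp with P? (λ ())
  ... | yes q = yes (λ h → resp (λ ()) q)
  ... | no ¬q = no (λ f → ¬q (f _))
  ∀V? (suc N) P? resp with all? (λ x → ∀V? N (λ h → P? (x ∷ᶠ h)) (λ eq → resp λ { Fin.zero → refl ; (Fin.suc i) → eq i }))
  ... | yes q = yes (λ h → resp (λ i → sym (head∷tail h i)) (q (h Fin.zero) (λ i → h (Fin.suc i))))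
  ... | no ¬q = no (λ f → ¬q (λ x h → f (x ∷ᶠ h)))

  ∷-++ : ∀ {m n} x (u : Vect m) (w : Vect n) → x ∷ᶠ (u ++ w) ≗ (x ∷ᶠ u) ++ w
  ∷-++ x u w Fin.zero = refl
  ∷-++ {m} x u w (Fin.suc i) with splitAt m i
  ... | inj₁ _ = refl
  ... | inj₂ _ = refl

  vsum-++ : ∀ m n (g : Vect (m ℕ.+ n) → ℕ) → Extensional g → vsum (m ℕ.+ n) g ≡ vsum m (λ u → vsum n (λ w → g (u ++ w)))
  vsum-++ zero    n g e = vsum-cong n (λ w → e (λ i → refl))
  vsum-++ (suc m) n g e =
    sum-cong-≗ {p} (λ x → trans (vsum-++ m n _ (Extensional-∷ e x)) (vsum-cong m (λ u → vsum-cong n (λ w → e (∷-++ x u w)))))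

  listSum-allFuns : ∀ {A : Set} m (xs : List A) g → listSum (allFuns (suc m) xs) g ≡ listSum xs (λ x → listSum (allFuns m xs) (λ f → g (x ∷ᶠ f)))
  listSum-allFuns m xs g = trans (listSum-concatMap _ xs g) (listSum-cong xs (λ x → listSum-map _ (allFuns m xs) g))

  listSum-allVectors : ∀ N g → listSum (allFuns N (List.allFin p)) g ≡ vsum N g
  listSum-allVectors zero    g = ℕP.+-identityʳ _
  listSum-allVectors (suc N) g =
    trans (listSum-allFuns N (List.allFin p) g) (trans (listSum-tabulate p (λ x → x) _) (sum-cong-≗ {p} (λ x → listSum-allVectors N _)))

  _≈M_ : ∀ {k n} → Mat k n → Mat k n → Set
  X ≈M Y = ∀ a j → X a j ≡ Y a j

  listSum-allMats : ∀ k n (g : Mat k n → ℕ) → (∀ {X Y} → X ≈M Y → g X ≡ g Y) →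
                    listSum (allMats k n) g ≡ vsum (k ℕ.* n) (λ x → g (unflatten x))
  listSum-allMats zero    n g e = trans (ℕP.+-identityʳ _) (e λ ())
  listSum-allMats (suc k) n g e = begin
    listSum (allFuns (suc k) (allFuns n (List.allFin p))) g
      ≡⟨ listSum-allFuns k (allFuns n (List.allFin p)) g ⟩
    listSum (allFuns n (List.allFin p)) (λ row → listSum (allMats k n) (λ X → g (row ∷ᶠ X)))
      ≡⟨ listSum-allVectors n _ ⟩
    vsum n (λ row → listSum (allMats k n) (λ X → g (row ∷ᶠ X)))
      ≡⟨ vsum-cong n (λ row → listSum-allMats k n _ (λ eq → e λ { Fin.zero j → refl ; (Fin.suc a) j → eq a j })) ⟩
    vsum n (λ row → vsum (k ℕ.* n) (λ w → g (row ∷ᶠ unflatten w)))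
      ≡⟨ vsum-cong n (λ row → vsum-cong (k ℕ.* n) (λ w → e λ { Fin.zero j → sym (lookup-++ˡ row w j)
                                                           ; (Fin.suc a) j → sym (lookup-++ʳ row w (combine a j)) })) ⟩
    vsum n (λ row → vsum (k ℕ.* n) (λ w → g (unflatten {m = suc k} {n = n} (row ++ w))))
      ≡⟨ vsum-++ n (k ℕ.* n) _ (λ eq → e (λ a j → eq (combine a j))) ⟨
    vsum (suc k ℕ.* n) (λ x → g (unflatten x))
      ∎
    where open ≡-Reasoning

-- Linear functionals on F_p^N

module LinearFunctionals (p : ℕ) .{{_ : NonZero p}} (p-prime : Prime p) where
  open Fp p
  open FpRing p
  open FpSolver using (solve; _:=_; _:+_; _:*_)
  open FpField p p-prime
  open Counting p

  record IsLinear {N} (ℓ : Vect N → F) : Set where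
    field
      ⊕-homo : ∀ u w → ℓ (u +V w) ≡ ℓ u ⊕ ℓ w
      ·-homo : ∀ c u → ℓ (c ·V u) ≡ c ⊗ ℓ u
      ≗-cong : ∀ {u w} → u ≗ w → ℓ u ≡ ℓ w
  open IsLinear public

  linear-0V : ∀ {N} {ℓ : Vect N → F} → IsLinear ℓ → ℓ 0V ≡ 0F
  linear-0V L = trans (≗-cong L (λ i → sym (zeroˡ 0F))) (trans (·-homo L 0F 0V) (zeroˡ _))

  isLinear-combination : ∀ {N} {ℓ₁ ℓ₂ : Vect N → F} → IsLinear ℓ₁ → IsLinear ℓ₂ → ∀ a b → IsLinear (λ h → a ⊗ ℓ₁ h ⊕ b ⊗ ℓ₂ h)
  isLinear-combination {ℓ₁ = ℓ₁} {ℓ₂} L₁ L₂ a b = record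
    { ⊕-homo = λ u w → trans (cong₂ (λ x y → a ⊗ x ⊕ b ⊗ y) (⊕-homo L₁ u w) (⊕-homo L₂ u w))
                         (solve 6 (λ x₁ y₁ x₂ y₂ a b → a :* (x₁ :+ y₁) :+ b :* (x₂ :+ y₂) := (a :* x₁ :+ b :* x₂) :+ (a :* y₁ :+ b :* y₂))
                                refl (ℓ₁ u) (ℓ₁ w) (ℓ₂ u) (ℓ₂ w) a b)
    ; ·-homo = λ c u → trans (cong₂ (λ x y → a ⊗ x ⊕ b ⊗ y) (·-homo L₁ c u) (·-homo L₂ c u))
                         (solve 5 (λ x y a b c → a :* (c :* x) :+ b :* (c :* y) := c :* (a :* x :+ b :* y)) refl (ℓ₁ u) (ℓ₂ u) a b c)
    ; ≗-cong = λ eq → cong₂ (λ x y → a ⊗ x ⊕ b ⊗ y) (≗-cong L₁ eq) (≗-cong L₂ eq) }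

  isLinear-tail : ∀ {N} {ℓ : Vect (suc N) → F} → IsLinear ℓ → IsLinear (λ h → ℓ (0F ∷ᶠ h))
  isLinear-tail L = record
    { ⊕-homo = λ u w → trans (≗-cong L λ { Fin.zero → sym (+-identityˡ 0F) ; (Fin.suc i) → refl }) (⊕-homo L (0F ∷ᶠ u) (0F ∷ᶠ w))
    ; ·-homo = λ c u → trans (≗-cong L λ { Fin.zero → sym (zeroʳ c) ; (Fin.suc i) → refl }) (·-homo L c (0F ∷ᶠ u))
    ; ≗-cong = λ eq → ≗-cong L λ { Fin.zero → refl ; (Fin.suc i) → eq i } }

  linear-∷ : ∀ {N} {ℓ : Vect (suc N) → F} → IsLinear ℓ → ∀ x h → ℓ (x ∷ᶠ h) ≡ x ⊗ ℓ (1F ∷ᶠ 0V) ⊕ ℓ (0F ∷ᶠ h)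
  linear-∷ {ℓ = ℓ} L x h =
    trans (≗-cong L split) (trans (⊕-homo L (x ·V (1F ∷ᶠ 0V)) (0F ∷ᶠ h)) (cong (_⊕ ℓ (0F ∷ᶠ h)) (·-homo L x (1F ∷ᶠ 0V))))
    where
    split : x ∷ᶠ h ≗ (x ·V (1F ∷ᶠ 0V)) +V (0F ∷ᶠ h)
    split Fin.zero    = sym (trans (+-identityʳ (x ⊗ 1F)) (*-identityʳ x))
    split (Fin.suc i) = sym (trans (cong (_⊕ h i) (zeroʳ x)) (+-identityˡ (h i)))

  Independent : ∀ {N s} → (Fin s → Vect N → F) → Set
  Independent {s = s} ℓ = ∀ (μ : Fin s → F) → (∀ h → sumF s (λ c → μ c ⊗ ℓ c h) ≡ 0F) → ∀ c → μ c ≡ 0F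

  inKernel? : ∀ {N s} (ℓ : Fin s → Vect N → F) (h : Vect N) → Dec (∀ c → ℓ c h ≡ 0F)
  inKernel? ℓ h = all? (λ c → ℓ c h Fin.≟ 0F)

  kernelSize : ∀ N {s} → (Fin s → Vect N → F) → ℕ
  kernelSize N ℓ = vsum N (λ h → 𝟙 (inKernel? ℓ h))

  kernelSize≤p^N : ∀ N {s} (ℓ : Fin s → Vect N → F) → kernelSize N ℓ ≤ p ^ N
  kernelSize≤p^N N ℓ =
    ℕP.≤-trans (vsum-mono-≤ N (λ h → 𝟙≤1 (inKernel? ℓ h))) (ℕP.≤-reflexive (trans (vsum-const N 1) (ℕP.*-identityʳ _)))

  -- One step of Gaussian elimination: ℓ j has a nonzero pivot G on the first coordinate, and
  -- the functionals G ℓ c − ℓ c (e₀) ℓ j (c ≠ j), restricted to the remaining coordinates,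
  -- carry the kernel of ℓ to at most one point per fibre.
  module Elimination {N s} (ℓ : Fin (suc s) → Vect (suc N) → F) (L : ∀ c → IsLinear (ℓ c)) (I : Independent ℓ)
                     (j : Fin (suc s)) (G≢0 : ℓ j (1F ∷ᶠ 0V) ≢ 0F) where

    γ : Fin (suc s) → F
    γ c = ℓ c (1F ∷ᶠ 0V)

    ℓ′ : Fin (suc s) → Vect N → F
    ℓ′ c h = ℓ c (0F ∷ᶠ h)

    G : F
    G = γ j

    eliminated : Fin s → Vect N → F
    eliminated i h = G ⊗ ℓ′ (punchIn j i) h ⊕ ⊝ γ (punchIn j i) ⊗ ℓ′ j h

    eliminated-isLinear : ∀ i → IsLinear (eliminated i)
    eliminated-isLinear i = isLinear-combination (isLinear-tail (L (punchIn j i))) (isLinear-tail (L j)) G (⊝ γ (punchIn j i))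

    ℓ-∷ : ∀ c x h → ℓ c (x ∷ᶠ h) ≡ x ⊗ γ c ⊕ ℓ′ c h
    ℓ-∷ c x h = linear-∷ (L c) x h

    kernel⇒eliminatedKernel : ∀ x h → (∀ c → ℓ c (x ∷ᶠ h) ≡ 0F) → ∀ i → eliminated i h ≡ 0F
    kernel⇒eliminatedKernel x h q i = begin
      G ⊗ ℓ′ (punchIn j i) h ⊕ ⊝ Γ ⊗ ℓ′ j h
        ≡⟨ cong₂ (λ a b → G ⊗ a ⊕ ⊝ Γ ⊗ b) (+-inverseʳ-unique (x ⊗ Γ) _ (trans (sym (ℓ-∷ (punchIn j i) x h)) (q (punchIn j i))))
                                            (+-inverseʳ-unique (x ⊗ G) _ (trans (sym (ℓ-∷ j x h)) (q j))) ⟩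
      G ⊗ ⊝ (x ⊗ Γ) ⊕ ⊝ Γ ⊗ ⊝ (x ⊗ G)
        ≡⟨ cong₂ _⊕_ (sym (-‿distribʳ-* G (x ⊗ Γ))) (trans (sym (-‿distribˡ-* Γ (⊝ (x ⊗ G))))
                       (trans (cong ⊝_ (sym (-‿distribʳ-* Γ (x ⊗ G)))) (-‿involutive (Γ ⊗ (x ⊗ G))))) ⟩
      ⊝ (G ⊗ (x ⊗ Γ)) ⊕ Γ ⊗ (x ⊗ G)
        ≡⟨ cong (⊝ (G ⊗ (x ⊗ Γ)) ⊕_) (solve 3 (λ Γ x G → Γ :* (x :* G) := G :* (x :* Γ)) refl Γ x G) ⟩
      ⊝ (G ⊗ (x ⊗ Γ)) ⊕ G ⊗ (x ⊗ Γ)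
        ≡⟨ -‿inverseˡ _ ⟩
      0F ∎
      where
      open ≡-Reasoning
      Γ = γ (punchIn j i)

    kernel-head-unique : ∀ h x y → (∀ c → ℓ c (x ∷ᶠ h) ≡ 0F) → (∀ c → ℓ c (y ∷ᶠ h) ≡ 0F) → x ≡ y
    kernel-head-unique h x y qx qy = x∙y⁻¹≈ε⇒x≈y x y (x*y≡0⇒x≡0 (x ⊕ ⊝ y) G [x-y]G≡0 G≢0)
      where
      xG≡yG : x ⊗ G ≡ y ⊗ G
      xG≡yG = +-cancelʳ (ℓ′ j h) (x ⊗ G) (y ⊗ G) (trans (sym (ℓ-∷ j x h)) (trans (qx j) (sym (trans (sym (ℓ-∷ j y h)) (qy j)))))
      [x-y]G≡0 : (x ⊕ ⊝ y) ⊗ G ≡ 0F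
      [x-y]G≡0 = trans (distribʳ G x (⊝ y)) (trans (cong₂ _⊕_ xG≡yG (sym (-‿distribˡ-* y G))) (-‿inverseʳ (y ⊗ G)))

    fibre-bound : ∀ h → sum (λ x → 𝟙 (inKernel? ℓ (x ∷ᶠ h))) ≤ 𝟙 (inKernel? eliminated h)
    fibre-bound h with inKernel? eliminated h
    ... | yes _  = sum-𝟙≤1 p (λ x → inKernel? ℓ (x ∷ᶠ h)) (λ x y → kernel-head-unique h x y)
    ... | no ¬k = ℕP.≤-reflexive (trans (sum-cong-≗ {p} (λ x → 𝟙-no (inKernel? ℓ (x ∷ᶠ h)) (λ q → ¬k (kernel⇒eliminatedKernel x h q))))
                                       (trans (sum-const p 0) (ℕP.*-zeroʳ p)))

    kernelSize-≤ : kernelSize (suc N) ℓ ≤ kernelSize N eliminated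
    kernelSize-≤ = ℕP.≤-trans (ℕP.≤-reflexive (sym (vsum-sum N p (λ h x → 𝟙 (inKernel? ℓ (x ∷ᶠ h)))))) (vsum-mono-≤ N fibre-bound)

    -- A dependency μ among the eliminated functionals lifts to the dependency
    -- (μ_i G at punchIn j i, −Σ μ_i γ_i at j) among the ℓ c.
    private
      A : (Fin s → F) → F
      A μ = sumF s (λ i → μ i ⊗ γ (punchIn j i))

      lift : (Fin s → F) → Fin (suc s) → F
      lift μ c with c Fin.≟ j
      ... | yes _ = ⊝ A μ
      ... | no ne = μ (punchOut {i = j} {j = c} (λ e → ne (sym e))) ⊗ G

      lift-j : ∀ μ → lift μ j ≡ ⊝ A μ
      lift-j μ with j Fin.≟ j
      ... | yes _ = refl
      ... | no ne = ⊥-elim (ne refl)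

      lift-punchIn : ∀ μ i → lift μ (punchIn j i) ≡ μ i ⊗ G
      lift-punchIn μ i with punchIn j i Fin.≟ j
      ... | yes e = ⊥-elim (punchInᵢ≢i j i e)
      ... | no ne = cong (λ z → μ z ⊗ G) (trans (punchOut-cong j refl) (punchOut-punchIn j))

      lift-dependency : ∀ μ → (∀ h → sumF s (λ i → μ i ⊗ eliminated i h) ≡ 0F) →
                        ∀ h → sumF (suc s) (λ c → lift μ c ⊗ ℓ c h) ≡ 0F
      lift-dependency μ H h = begin
        sumF (suc s) (λ c → lift μ c ⊗ ℓ c h)
          ≡⟨ sumF-cong (suc s) (λ c → cong (lift μ c ⊗_) (trans (≗-cong (L c) (head∷tail h)) (ℓ-∷ c x h′))) ⟩
        sumF (suc s) (λ c → lift μ c ⊗ (x ⊗ γ c ⊕ ℓ′ c h′))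
          ≡⟨ sumF-remove s j (λ c → lift μ c ⊗ (x ⊗ γ c ⊕ ℓ′ c h′)) ⟩
        lift μ j ⊗ (x ⊗ G ⊕ ℓ′ j h′) ⊕ sumF s (λ i → lift μ (punchIn j i) ⊗ (x ⊗ γ (punchIn j i) ⊕ ℓ′ (punchIn j i) h′))
          ≡⟨ cong₂ (λ a b → a ⊗ (x ⊗ G ⊕ ℓ′ j h′) ⊕ b) (lift-j μ)
                   (sumF-cong s (λ i → trans (cong (_⊗ (x ⊗ γ (punchIn j i) ⊕ ℓ′ (punchIn j i) h′)) (lift-punchIn μ i)) (expand i))) ⟩
        ⊝ A μ ⊗ (x ⊗ G ⊕ ℓ′ j h′) ⊕ sumF s (λ i → (G ⊗ x) ⊗ (μ i ⊗ γ (punchIn j i)) ⊕ G ⊗ (μ i ⊗ ℓ′ (punchIn j i) h′))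
          ≡⟨ cong (⊝ A μ ⊗ (x ⊗ G ⊕ ℓ′ j h′) ⊕_) (trans (sumF-+ s _ _) (cong₂ _⊕_ (sumF-*ˡ s (G ⊗ x) _) (sumF-*ˡ s G _))) ⟩
        ⊝ A μ ⊗ (x ⊗ G ⊕ ℓ′ j h′) ⊕ ((G ⊗ x) ⊗ A μ ⊕ G ⊗ B)
          ≡⟨ solve 6 (λ a x G l A B → a :* (x :* G :+ l) :+ ((G :* x) :* A :+ G :* B) := (G :* B :+ a :* l) :+ (x :* G) :* (a :+ A))
                     refl (⊝ A μ) x G (ℓ′ j h′) (A μ) B ⟩
        (G ⊗ B ⊕ ⊝ A μ ⊗ ℓ′ j h′) ⊕ (x ⊗ G) ⊗ (⊝ A μ ⊕ A μ)
          ≡⟨ cong₂ _⊕_ combination≡0 (trans (cong ((x ⊗ G) ⊗_) (-‿inverseˡ (A μ))) (zeroʳ (x ⊗ G))) ⟩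
        0F ⊕ 0F
          ≡⟨ +-identityˡ 0F ⟩
        0F ∎
        where
        open ≡-Reasoning
        x = h Fin.zero
        h′ : Vect N
        h′ i = h (Fin.suc i)
        B = sumF s (λ i → μ i ⊗ ℓ′ (punchIn j i) h′)
        expand : ∀ i → (μ i ⊗ G) ⊗ (x ⊗ γ (punchIn j i) ⊕ ℓ′ (punchIn j i) h′) ≡
                       (G ⊗ x) ⊗ (μ i ⊗ γ (punchIn j i)) ⊕ G ⊗ (μ i ⊗ ℓ′ (punchIn j i) h′)
        expand i = solve 5 (λ m G x c l → (m :* G) :* (x :* c :+ l) := (G :* x) :* (m :* c) :+ G :* (m :* l))
                           refl (μ i) G x (γ (punchIn j i)) (ℓ′ (punchIn j i) h′)
        term : ∀ i → G ⊗ (μ i ⊗ ℓ′ (punchIn j i) h′) ⊕ ⊝ (μ i ⊗ γ (punchIn j i)) ⊗ ℓ′ j h′ ≡ μ i ⊗ eliminated i h′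
        term i = trans (cong (λ z → G ⊗ (μ i ⊗ ℓ′ (punchIn j i) h′) ⊕ z ⊗ ℓ′ j h′) (-‿distribʳ-* (μ i) (γ (punchIn j i))))
                       (solve 5 (λ G m l c l′ → G :* (m :* l) :+ (m :* c) :* l′ := m :* (G :* l :+ c :* l′))
                              refl G (μ i) (ℓ′ (punchIn j i) h′) (⊝ γ (punchIn j i)) (ℓ′ j h′))
        combination≡0 : G ⊗ B ⊕ ⊝ A μ ⊗ ℓ′ j h′ ≡ 0F
        combination≡0 = begin
          G ⊗ B ⊕ ⊝ A μ ⊗ ℓ′ j h′
            ≡⟨ cong₂ _⊕_ (sumF-*ˡ s G _) (trans (sumF-*ʳ s (ℓ′ j h′) _) (cong (_⊗ ℓ′ j h′) (sumF-⊝ s _))) ⟨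
          sumF s (λ i → G ⊗ (μ i ⊗ ℓ′ (punchIn j i) h′)) ⊕ sumF s (λ i → ⊝ (μ i ⊗ γ (punchIn j i)) ⊗ ℓ′ j h′)
            ≡⟨ sumF-+ s _ _ ⟨
          sumF s (λ i → G ⊗ (μ i ⊗ ℓ′ (punchIn j i) h′) ⊕ ⊝ (μ i ⊗ γ (punchIn j i)) ⊗ ℓ′ j h′)
            ≡⟨ trans (sumF-cong s term) (H h′) ⟩
          0F ∎

    eliminated-independent : Independent eliminated
    eliminated-independent μ H i =
      x*y≡0⇒x≡0 (μ i) G (trans (sym (lift-punchIn μ i)) (I (lift μ) (lift-dependency μ H) (punchIn j i))) G≢0

  kernelSize*p^s≤p^N : ∀ N s (ℓ : Fin s → Vect N → F) → (∀ c → IsLinear (ℓ c)) → Independent ℓ → kernelSize N ℓ ℕ.* p ^ s ≤ p ^ N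
  kernelSize*p^s≤p^N N zero ℓ L I = ℕP.≤-trans (ℕP.≤-reflexive (ℕP.*-identityʳ _)) (kernelSize≤p^N N ℓ)
  kernelSize*p^s≤p^N zero (suc s) ℓ L I = ⊥-elim (1≢0 (I (λ _ → 1F) all-zero Fin.zero))
    where
    all-zero : ∀ h → sumF (suc s) (λ c → 1F ⊗ ℓ c h) ≡ 0F
    all-zero h = trans (sumF-cong (suc s) (λ c → trans (cong (1F ⊗_) (trans (≗-cong (L c) {h} {0V} λ ()) (linear-0V (L c)))) (zeroʳ 1F)))
                       (sumF-0 (suc s))
  kernelSize*p^s≤p^N (suc N) (suc s) ℓ L I with all? (λ c → ℓ c (1F ∷ᶠ 0V) Fin.≟ 0F)
  ... | yes no-pivot = ℕP.≤-trans (ℕP.≤-reflexive (trans (cong (ℕ._* p ^ suc s) kernelSize≡) (ℕP.*-assoc p _ _)))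
                                  (ℕP.*-monoʳ-≤ p (kernelSize*p^s≤p^N N (suc s) ℓ′ (λ c → isLinear-tail (L c)) I′))
    where
    ℓ′ : Fin (suc s) → Vect N → F
    ℓ′ c h = ℓ c (0F ∷ᶠ h)
    head-irrelevant : ∀ c x h → ℓ c (x ∷ᶠ h) ≡ ℓ′ c h
    head-irrelevant c x h = trans (linear-∷ (L c) x h) (trans (cong (λ z → x ⊗ z ⊕ ℓ′ c h) (no-pivot c))
                                                       (trans (cong (_⊕ ℓ′ c h) (zeroʳ x)) (+-identityˡ _)))
    kernelSize≡ : kernelSize (suc N) ℓ ≡ p ℕ.* kernelSize N ℓ′
    kernelSize≡ = trans (sum-cong-≗ {p} (λ x → vsum-cong N (λ h → 𝟙-cong (inKernel? ℓ (x ∷ᶠ h)) (inKernel? ℓ′ h)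
                          (λ q c → trans (sym (head-irrelevant c x h)) (q c)) (λ q c → trans (head-irrelevant c x h) (q c)))))
                        (sum-const p _)
    I′ : Independent ℓ′
    I′ μ H = I μ (λ h → trans (sumF-cong (suc s) (λ c → cong (μ c ⊗_) (trans (≗-cong (L c) (head∷tail h)) (head-irrelevant c _ _))))
                              (H (λ i → h (Fin.suc i))))
  ... | no has-pivot with ¬∀⟶∃¬ (suc s) _ (λ c → ℓ c (1F ∷ᶠ 0V) Fin.≟ 0F) has-pivot
  ... | j , G≢0 = ℕP.≤-trans (ℕP.*-monoˡ-≤ (p ℕ.* p ^ s) kernelSize-≤)
                  (ℕP.≤-trans (ℕP.≤-reflexive (swap-factors (kernelSize N eliminated) p (p ^ s)))
                              (ℕP.*-monoʳ-≤ p (kernelSize*p^s≤p^N N s eliminated eliminated-isLinear eliminated-independent)))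
    where
    open Elimination ℓ L I j G≢0
    swap-factors : ∀ a b c → a ℕ.* (b ℕ.* c) ≡ b ℕ.* (a ℕ.* c)
    swap-factors = ℕ-Solver.solve-∀

  solutions≤kernelSize : ∀ N {s} (ℓ : Fin s → Vect N → F) (b : Fin s → F) → (∀ c → IsLinear (ℓ c)) →
                         vsum N (λ h → 𝟙 (all? (λ c → ℓ c h Fin.≟ b c))) ≤ kernelSize N ℓ
  solutions≤kernelSize N ℓ b L with vsum N (λ h → 𝟙 (all? (λ c → ℓ c h Fin.≟ b c))) in eq
  ... | zero  = z≤n
  ... | suc _ with vsum-pos N (λ h → 𝟙 (all? (λ c → ℓ c h Fin.≟ b c))) (subst (0 <_) (sym eq) (s≤s z≤n))
  ... | h₀ , q = subst (_≤ kernelSize N ℓ) eq (ℕP.≤-reflexive (trans (sym (vsum-translate N extensional h₀)) (vsum-cong N shift)))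
    where
    solution : ∀ c → ℓ c h₀ ≡ b c
    solution = 𝟙-pos (all? (λ c → ℓ c h₀ Fin.≟ b c)) q
    extensional : Extensional (λ h → 𝟙 (all? (λ c → ℓ c h Fin.≟ b c)))
    extensional eq′ = 𝟙-cong (all? _) (all? _) (λ z c → trans (≗-cong (L c) (λ i → sym (eq′ i))) (z c))
                                                (λ z c → trans (≗-cong (L c) eq′) (z c))
    shift : ∀ h → 𝟙 (all? (λ c → ℓ c (h₀ +V h) Fin.≟ b c)) ≡ 𝟙 (inKernel? ℓ h)
    shift h = 𝟙-cong (all? _) (inKernel? ℓ h)
      (λ z c → +-identityʳ-unique (b c) (ℓ c h) (trans (sym (trans (⊕-homo (L c) h₀ h) (cong (_⊕ ℓ c h) (solution c)))) (z c)))
      (λ z c → trans (⊕-homo (L c) h₀ h) (trans (cong₂ _⊕_ (solution c) (z c)) (+-identityʳ (b c))))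

  matrixDot : ∀ k n → (Fin k → Fin n → F) → Vect (k ℕ.* n) → F
  matrixDot k n M h = sumF k (λ b → sumF n (λ j → M b j ⊗ h (combine b j)))

  isLinear-matrixDot : ∀ k n (M : Fin k → Fin n → F) → IsLinear (matrixDot k n M)
  isLinear-matrixDot k n M = record
    { ⊕-homo = λ u w → trans (sumF-cong k (λ b → sumF-cong n (λ j → distribˡ (M b j) _ _))) (sumF₂-+ k n _ _)
    ; ·-homo = λ c u → trans (sumF-cong k (λ b → sumF-cong n (λ j →
                         solve 3 (λ m c u → m :* (c :* u) := c :* (m :* u)) refl (M b j) c (u (combine b j)))))
                       (sumF₂-*ˡ k n c _)
    ; ≗-cong = λ eq → sumF-cong k (λ b → sumF-cong n (λ j → cong (M b j ⊗_) (eq (combine b j)))) }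

  matrixDot-basis : ∀ k n (M : Fin k → Fin n → F) b₀ j₀ → matrixDot k n M (basis (combine b₀ j₀)) ≡ M b₀ j₀
  matrixDot-basis k n M b₀ j₀ = trans (sumF-cong k (λ b → sumF-cong n (λ j → *-comm (M b j) _))) (sumF₂-basis k n b₀ j₀ M)

-- Symmetric and skew-symmetric matrices through their upper triangles

module Triangles (p : ℕ) .{{_ : NonZero p}} where
  open Fp p
  open FpRing p

  upper-injective : ∀ k (M M′ : Mat k k) → Symmetric M → Symmetric M′ → (∀ t → upper k M t ≡ upper k M′ t) → ∀ a b → M a b ≡ M′ a b
  upper-injective (suc k) M M′ sM sM′ h = go
    where
    parts = ++-split _≡_ (M Fin.zero) (M′ Fin.zero) (upper k (lower M)) (upper k (lower M′))
                     (λ t → trans (sym (upper-++ k M t)) (trans (h t) (upper-++ k M′ t)))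
    go : ∀ a b → M a b ≡ M′ a b
    go Fin.zero    b           = proj₁ parts b
    go (Fin.suc a) Fin.zero    = trans (sM _ _) (trans (proj₁ parts (Fin.suc a)) (sM′ _ _))
    go (Fin.suc a) (Fin.suc b) = upper-injective k (lower M) (lower M′) (λ _ _ → sM _ _) (λ _ _ → sM′ _ _) (proj₂ parts) a b

  module _ (p-prime : Prime p) (p≢2 : p ≢ 2) where
    open FpField p p-prime

    skew-diagonal : ∀ {k} (M : Mat k k) → SkewSymmetric M → ∀ a → M a a ≡ 0F
    skew-diagonal M sM a = x+x≡0⇒x≡0 p≢2 (M a a) (trans (cong (M a a ⊕_) (sM a a)) (-‿inverseʳ (M a a)))

    strictUpper-injective : ∀ k (M M′ : Mat k k) → SkewSymmetric M → SkewSymmetric M′ →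
                            (∀ t → strictUpper k M t ≡ strictUpper k M′ t) → ∀ a b → M a b ≡ M′ a b
    strictUpper-injective (suc k) M M′ sM sM′ h = go
      where
      parts = ++-split _≡_ (λ b → M Fin.zero (Fin.suc b)) (λ b → M′ Fin.zero (Fin.suc b)) (strictUpper k (lower M)) (strictUpper k (lower M′))
                       (λ t → trans (sym (strictUpper-++ k M t)) (trans (h t) (strictUpper-++ k M′ t)))
      go : ∀ a b → M a b ≡ M′ a b
      go Fin.zero    Fin.zero    = trans (skew-diagonal M sM Fin.zero) (sym (skew-diagonal M′ sM′ Fin.zero))
      go Fin.zero    (Fin.suc b) = proj₁ parts b
      go (Fin.suc a) Fin.zero    = trans (sM _ _) (trans (cong ⊝_ (proj₁ parts a)) (sym (sM′ _ _)))
      go (Fin.suc a) (Fin.suc b) =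
        strictUpper-injective k (lower M) (lower M′) (λ _ _ → sM _ _) (λ _ _ → sM′ _ _) (proj₂ parts) a b

  -- The coefficient matrices dual to the upper-triangle coordinates.
  fromUpper : ∀ k → Vect (triangle k) → Mat k k
  fromUpper (suc k) λ′ Fin.zero    b           = λ′ (b ↑ˡ triangle k)
  fromUpper (suc k) λ′ (Fin.suc a) Fin.zero    = 0F
  fromUpper (suc k) λ′ (Fin.suc a) (Fin.suc b) = fromUpper k (λ c → λ′ (suc k ↑ʳ c)) a b

  fromStrictUpper : ∀ k → Vect (strictTriangle k) → Mat k k
  fromStrictUpper (suc k) λ′ Fin.zero    Fin.zero    = 0F
  fromStrictUpper (suc k) λ′ Fin.zero    (Fin.suc b) = λ′ (b ↑ˡ strictTriangle k)
  fromStrictUpper (suc k) λ′ (Fin.suc a) Fin.zero    = 0F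
  fromStrictUpper (suc k) λ′ (Fin.suc a) (Fin.suc b) = fromStrictUpper k (λ c → λ′ (k ↑ʳ c)) a b

  private
    0*x+y≡y : ∀ x y → 0F ⊗ x ⊕ y ≡ y
    0*x+y≡y x y = trans (cong (_⊕ y) (zeroˡ x)) (+-identityˡ y)

  dot-upper : ∀ k (λ′ : Vect (triangle k)) (M : Mat k k) → dot λ′ (upper k M) ≡ sumF k (λ a → sumF k (λ b → fromUpper k λ′ a b ⊗ M a b))
  dot-upper zero    λ′ M = refl
  dot-upper (suc k) λ′ M = begin
    dot λ′ (upper (suc k) M)
      ≡⟨ sumF-cong _ (λ c → cong (λ′ c ⊗_) (upper-++ k M c)) ⟩
    dot λ′ (M Fin.zero ++ upper k (lower M))
      ≡⟨ dot-++ (suc k) (triangle k) λ′ (M Fin.zero) (upper k (lower M)) ⟩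
    sumF (suc k) (λ b → λ′ (b ↑ˡ triangle k) ⊗ M Fin.zero b) ⊕ dot (λ c → λ′ (suc k ↑ʳ c)) (upper k (lower M))
      ≡⟨ cong (sumF (suc k) (λ b → λ′ (b ↑ˡ triangle k) ⊗ M Fin.zero b) ⊕_)
              (trans (dot-upper k _ (lower M)) (sumF-cong k (λ a → sym (0*x+y≡y (M (Fin.suc a) Fin.zero) _)))) ⟩
    sumF (suc k) (λ a → sumF (suc k) (λ b → fromUpper (suc k) λ′ a b ⊗ M a b))
      ∎
    where open ≡-Reasoning

  dot-strictUpper : ∀ k (λ′ : Vect (strictTriangle k)) (M : Mat k k) →
                    dot λ′ (strictUpper k M) ≡ sumF k (λ a → sumF k (λ b → fromStrictUpper k λ′ a b ⊗ M a b))
  dot-strictUpper zero    λ′ M = refl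
  dot-strictUpper (suc k) λ′ M = begin
    dot λ′ (strictUpper (suc k) M)
      ≡⟨ sumF-cong _ (λ c → cong (λ′ c ⊗_) (strictUpper-++ k M c)) ⟩
    dot λ′ ((λ b → M Fin.zero (Fin.suc b)) ++ strictUpper k (lower M))
      ≡⟨ dot-++ k (strictTriangle k) λ′ _ (strictUpper k (lower M)) ⟩
    sumF k (λ b → λ′ (b ↑ˡ strictTriangle k) ⊗ M Fin.zero (Fin.suc b)) ⊕ dot (λ c → λ′ (k ↑ʳ c)) (strictUpper k (lower M))
      ≡⟨ cong₂ _⊕_ (sym (0*x+y≡y (M Fin.zero Fin.zero) _))
                   (trans (dot-strictUpper k _ (lower M)) (sumF-cong k (λ a → sym (0*x+y≡y (M (Fin.suc a) Fin.zero) _)))) ⟩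
    sumF (suc k) (λ a → sumF (suc k) (λ b → fromStrictUpper (suc k) λ′ a b ⊗ M a b))
      ∎
    where open ≡-Reasoning

  fromUpper-zero : ∀ k (λ′ : Vect (triangle k)) → (∀ a b → fromUpper k λ′ a b ≡ 0F) → ∀ c → λ′ c ≡ 0F
  fromUpper-zero (suc k) λ′ h c with splitAt-cases (suc k) (triangle k) c
  ... | inj₁ (b , refl) = h Fin.zero b
  ... | inj₂ (c′ , refl) = fromUpper-zero k (λ c → λ′ (suc k ↑ʳ c)) (λ a b → h (Fin.suc a) (Fin.suc b)) c′

  fromStrictUpper-zero : ∀ k (λ′ : Vect (strictTriangle k)) → (∀ a b → fromStrictUpper k λ′ a b ≡ 0F) → ∀ c → λ′ c ≡ 0F
  fromStrictUpper-zero (suc k) λ′ h c with splitAt-cases k (strictTriangle k) c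
  ... | inj₁ (b , refl) = h Fin.zero (Fin.suc b)
  ... | inj₂ (c′ , refl) = fromStrictUpper-zero k (λ c → λ′ (k ↑ʳ c)) (λ a b → h (Fin.suc a) (Fin.suc b)) c′

  fromUpper-upper : ∀ k (λ′ : Vect (triangle k)) a b → fromUpper k λ′ a b ≢ 0F → a ≢ b → fromUpper k λ′ b a ≡ 0F
  fromUpper-upper (suc k) λ′ Fin.zero    Fin.zero    _  a≢b = ⊥-elim (a≢b refl)
  fromUpper-upper (suc k) λ′ Fin.zero    (Fin.suc b) _  _   = refl
  fromUpper-upper (suc k) λ′ (Fin.suc a) Fin.zero    nz _   = ⊥-elim (nz refl)
  fromUpper-upper (suc k) λ′ (Fin.suc a) (Fin.suc b) nz a≢b = fromUpper-upper k _ a b nz (λ e → a≢b (cong Fin.suc e))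

  fromStrictUpper-upper : ∀ k (λ′ : Vect (strictTriangle k)) a b → fromStrictUpper k λ′ a b ≢ 0F → fromStrictUpper k λ′ b a ≡ 0F
  fromStrictUpper-upper (suc k) λ′ Fin.zero    Fin.zero    nz = ⊥-elim (nz refl)
  fromStrictUpper-upper (suc k) λ′ Fin.zero    (Fin.suc b) _  = refl
  fromStrictUpper-upper (suc k) λ′ (Fin.suc a) Fin.zero    nz = ⊥-elim (nz refl)
  fromStrictUpper-upper (suc k) λ′ (Fin.suc a) (Fin.suc b) nz = fromStrictUpper-upper k _ a b nz

-- Matrix-valued quadratic forms

module QuadraticForms (p : ℕ) .{{_ : NonZero p}} where
  open Fp p
  open FpRing p
  open FpSolver using (solve; _:=_; _:+_; _:*_)
  open Counting p using (_≈M_)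

  _+M_ : ∀ {k n} → Mat k n → Mat k n → Mat k n
  (X +M Y) a j = X a j ⊕ Y a j

  _·M_ : ∀ {k n} → F → Mat k n → Mat k n
  (c ·M X) a j = c ⊗ X a j

  polar : ∀ {k n} → Mat k n → Mat k n → Mat n n → Mat k k
  polar {n = n} X H M a b = sumF n (λ j → sumF n (λ m → (X a j ⊗ M j m) ⊗ H b m ⊕ (H a j ⊗ M j m) ⊗ X b m))

  matVec-+ : ∀ {k n} (X Y : Mat k n) r a → matVec (X +M Y) r a ≡ matVec X r a ⊕ matVec Y r a
  matVec-+ {n = n} X Y r a = trans (sumF-cong n (λ j → distribʳ (r j) (X a j) (Y a j))) (sumF-+ n _ _)

  matVec-· : ∀ {k n} c (X : Mat k n) r a → matVec (c ·M X) r a ≡ c ⊗ matVec X r a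
  matVec-· {n = n} c X r a = trans (sumF-cong n (λ j → *-assoc c (X a j) (r j))) (sumF-*ˡ n c _)

  matVec-cong : ∀ {k n} {X Y : Mat k n} → X ≈M Y → ∀ r a → matVec X r a ≡ matVec Y r a
  matVec-cong {n = n} eq r a = sumF-cong n (λ j → cong (_⊗ r j) (eq a j))

  quadForm-cong : ∀ {k n} {X Y : Mat k n} → X ≈M Y → ∀ M a b → quadForm X M a b ≡ quadForm Y M a b
  quadForm-cong {n = n} eq M a b = sumF-cong n (λ j → sumF-cong n (λ m → cong₂ (λ x y → (x ⊗ M j m) ⊗ y) (eq a j) (eq b m)))

  polar-cong : ∀ {k n} {X Y : Mat k n} → X ≈M Y → ∀ H M a b → polar X H M a b ≡ polar Y H M a b
  polar-cong {n = n} eq H M a b = sumF-cong n (λ j → sumF-cong n (λ m →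
    cong₂ (λ x y → (x ⊗ M j m) ⊗ H b m ⊕ (H a j ⊗ M j m) ⊗ y) (eq a j) (eq b m)))

  quadForm-+ : ∀ {k n} (X H : Mat k n) M a b → quadForm (X +M H) M a b ≡ quadForm X M a b ⊕ (polar X H M a b ⊕ quadForm H M a b)
  quadForm-+ {n = n} X H M a b = trans (sumF-cong n (λ j → sumF-cong n (λ m → expand j m)))
    (trans (sumF₂-+ n n _ _) (cong (quadForm X M a b ⊕_) (sumF₂-+ n n _ _)))
    where
    expand : ∀ j m → ((X a j ⊕ H a j) ⊗ M j m) ⊗ (X b m ⊕ H b m) ≡
                     (X a j ⊗ M j m) ⊗ X b m ⊕ (((X a j ⊗ M j m) ⊗ H b m ⊕ (H a j ⊗ M j m) ⊗ X b m) ⊕ (H a j ⊗ M j m) ⊗ H b m)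
    expand j m = solve 5 (λ x h m x′ h′ → ((x :+ h) :* m) :* (x′ :+ h′) := (x :* m) :* x′ :+ (((x :* m) :* h′ :+ (h :* m) :* x′) :+ (h :* m) :* h′))
                         refl (X a j) (H a j) (M j m) (X b m) (H b m)

  quadForm-symmetric : ∀ {k n} (X : Mat k n) M → Symmetric M → ∀ a b → quadForm X M a b ≡ quadForm X M b a
  quadForm-symmetric {n = n} X M sM a b = trans (sumF-comm n n _) (sumF-cong n (λ j → sumF-cong n (λ m →
    trans (cong (λ z → (X a m ⊗ z) ⊗ X b j) (sM m j))
          (solve 3 (λ x m y → (x :* m) :* y := (y :* m) :* x) refl (X a m) (M j m) (X b j)))))

  quadForm-skew : ∀ {k n} (X : Mat k n) M → SkewSymmetric M → ∀ a b → quadForm X M a b ≡ ⊝ quadForm X M b a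
  quadForm-skew {n = n} X M sM a b = trans (sumF-comm n n _)
    (trans (sumF-cong n (λ j → sumF-cong n (λ m → term j m))) (trans (sumF-cong n (λ j → sumF-⊝ n _)) (sumF-⊝ n _)))
    where
    term : ∀ j m → (X a m ⊗ M m j) ⊗ X b j ≡ ⊝ ((X b j ⊗ M j m) ⊗ X a m)
    term j m = begin
      (X a m ⊗ M m j) ⊗ X b j       ≡⟨ cong (λ z → (X a m ⊗ z) ⊗ X b j) (sM m j) ⟩
      (X a m ⊗ ⊝ M j m) ⊗ X b j     ≡⟨ cong (_⊗ X b j) (-‿distribʳ-* (X a m) (M j m)) ⟨
      ⊝ (X a m ⊗ M j m) ⊗ X b j     ≡⟨ -‿distribˡ-* (X a m ⊗ M j m) (X b j) ⟨
      ⊝ ((X a m ⊗ M j m) ⊗ X b j)   ≡⟨ cong ⊝_ (solve 3 (λ x m y → (x :* m) :* y := (y :* m) :* x) refl (X a m) (M j m) (X b j)) ⟩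
      ⊝ ((X b j ⊗ M j m) ⊗ X a m)   ∎
      where open ≡-Reasoning

  polar-+ˡ : ∀ {k n} (X Y H : Mat k n) M a b → polar (X +M Y) H M a b ≡ polar X H M a b ⊕ polar Y H M a b
  polar-+ˡ {n = n} X Y H M a b = trans (sumF-cong n (λ j → sumF-cong n (λ m →
    solve 7 (λ x y m h′ h x′ y′ → ((x :+ y) :* m) :* h′ :+ (h :* m) :* (x′ :+ y′)
                                 := ((x :* m) :* h′ :+ (h :* m) :* x′) :+ ((y :* m) :* h′ :+ (h :* m) :* y′))
            refl (X a j) (Y a j) (M j m) (H b m) (H a j) (X b m) (Y b m)))) (sumF₂-+ n n _ _)

  polar-·ˡ : ∀ {k n} c (X H : Mat k n) M a b → polar (c ·M X) H M a b ≡ c ⊗ polar X H M a b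
  polar-·ˡ {n = n} c X H M a b = trans (sumF-cong n (λ j → sumF-cong n (λ m →
    solve 6 (λ c x m h′ h x′ → ((c :* x) :* m) :* h′ :+ (h :* m) :* (c :* x′) := c :* ((x :* m) :* h′ :+ (h :* m) :* x′))
            refl c (X a j) (M j m) (H b m) (H a j) (X b m)))) (sumF₂-*ˡ n n c _)

  mulᵀ : ∀ {k n} → Mat n n → Mat k n → Fin n → Fin k → F
  mulᵀ {n = n} M H j₀ b = sumF n (λ m → M j₀ m ⊗ H b m)

  mul : ∀ {k n} → Mat k n → Mat n n → Fin k → Fin n → F
  mul {n = n} H M a j₀ = sumF n (λ j → H a j ⊗ M j j₀)

  mul-symmetric : ∀ {k n} (H : Mat k n) M → Symmetric M → ∀ a j₀ → mul H M a j₀ ≡ mulᵀ M H j₀ a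
  mul-symmetric {n = n} H M sM a j₀ = sumF-cong n (λ j → trans (*-comm (H a j) (M j j₀)) (cong (_⊗ H a j) (sM j j₀)))

  mul-skew : ∀ {k n} (H : Mat k n) M → SkewSymmetric M → ∀ a j₀ → mul H M a j₀ ≡ ⊝ mulᵀ M H j₀ a
  mul-skew {n = n} H M sM a j₀ = trans (sumF-cong n (λ j →
    trans (*-comm (H a j) (M j j₀)) (trans (cong (_⊗ H a j) (sM j j₀)) (sym (-‿distribˡ-* (M j₀ j) (H a j))))))
    (sumF-⊝ n _)

  polar-basis : ∀ {k n} (H : Mat k n) M a₀ j₀ a b →
                polar (unflatten (basis (combine a₀ j₀))) H M a b ≡ basis a₀ a ⊗ mulᵀ M H j₀ b ⊕ basis a₀ b ⊗ mul H M a j₀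
  polar-basis {n = n} H M a₀ j₀ a b = trans (sumF₂-+ n n _ _) (cong₂ _⊕_ left right)
    where
    left : sumF n (λ j → sumF n (λ m → (basis (combine a₀ j₀) (combine a j) ⊗ M j m) ⊗ H b m)) ≡ basis a₀ a ⊗ mulᵀ M H j₀ b
    left = trans (sumF-cong n (λ j → sumF-cong n (λ m → trans (cong (λ z → (z ⊗ M j m) ⊗ H b m) (basis-combine a₀ j₀ a j))
                   (solve 4 (λ u v m h → ((u :* v) :* m) :* h := u :* (v :* (m :* h))) refl (basis a₀ a) (basis j₀ j) (M j m) (H b m)))))
           (trans (sumF₂-*ˡ n n (basis a₀ a) _) (cong (basis a₀ a ⊗_) (trans (sumF-cong n (λ j → sumF-*ˡ n (basis j₀ j) _)) (sumF-basis n j₀ _))))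
    right : sumF n (λ j → sumF n (λ m → (H a j ⊗ M j m) ⊗ basis (combine a₀ j₀) (combine b m))) ≡ basis a₀ b ⊗ mul H M a j₀
    right = trans (sumF-cong n (λ j → sumF-cong n (λ m → trans (cong ((H a j ⊗ M j m) ⊗_) (basis-combine a₀ j₀ b m))
                    (solve 4 (λ h m u v → (h :* m) :* (u :* v) := u :* (v :* (h :* m))) refl (H a j) (M j m) (basis a₀ b) (basis j₀ m)))))
            (trans (sumF₂-*ˡ n n (basis a₀ b) _) (cong (basis a₀ b ⊗_) (sumF-cong n (λ j → sumF-basis n j₀ (λ m → H a j ⊗ M j m)))))

  sumF₂-basis-row-column : ∀ {k} (S : Mat k k) (P Q : Fin k → F) a₀ →
    sumF k (λ a → sumF k (λ b → S a b ⊗ (basis a₀ a ⊗ P b ⊕ basis a₀ b ⊗ Q a))) ≡ sumF k (λ b → S a₀ b ⊗ P b) ⊕ sumF k (λ a → S a a₀ ⊗ Q a)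
  sumF₂-basis-row-column {k} S P Q a₀ = trans (sumF-cong k (λ a → sumF-cong k (λ b →
      solve 5 (λ s u x v y → s :* (u :* x :+ v :* y) := u :* (s :* x) :+ v :* (s :* y)) refl (S a b) (basis a₀ a) (P b) (basis a₀ b) (Q a))))
    (trans (sumF₂-+ k k _ _) (cong₂ _⊕_ (trans (sumF-cong k (λ a → sumF-*ˡ k (basis a₀ a) _)) (sumF-basis k a₀ _))
                                        (sumF-cong k (λ a → sumF-basis k a₀ (λ b → S a b ⊗ Q a)))))

-- The coordinates of B(X)

module FactorCoordinates (p : ℕ) .{{_ : NonZero p}} (p-prime : Prime p) (p≢2 : p ≢ 2)
                         (k : ℕ) {n d₁ d₂ d₃ : ℕ} (𝔅 : Fp.QFactor p n d₁ d₂ d₃) where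
  open Fp p
  open FpRing p
  open FpSolver using (solve; _:=_; _:+_; _:*_)
  open Counting p
  open LinearFunctionals p p-prime
  open Triangles p
  open QuadraticForms p
  open QFactor 𝔅 renaming (vec to r; sym to Ms; skew to Ns)

  N m₁ m₂ m : ℕ
  N  = k ℕ.* n
  m₁ = d₁ ℕ.* k
  m₂ = d₂ ℕ.* triangle k ℕ.+ d₃ ℕ.* strictTriangle k
  m  = m₁ ℕ.+ m₂

  quadCoords : (Fin d₂ → Mat k k) → (Fin d₃ → Mat k k) → Vect m₂
  quadCoords A B = flatten (λ i → upper k (A i)) ++ flatten (λ i → strictUpper k (B i))

  coords : Mat k n → Vect m
  coords X = flatten (λ i a → matVec X (r i) a) ++ quadCoords (λ i → quadForm X (Ms i)) (λ i → quadForm X (Ns i))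

  targetCoords : (Fin d₁ → Vect k) → (Fin d₂ → Mat k k) → (Fin d₃ → Mat k k) → Vect m
  targetCoords v U V = flatten v ++ quadCoords U V

  quadCoords-pointwise : (R : F → F → Set) → ∀ {A A′ B B′} → (∀ i a b → R (A i a b) (A′ i a b)) → (∀ i a b → R (B i a b) (B′ i a b)) →
                         ∀ t → R (quadCoords A B t) (quadCoords A′ B′ t)
  quadCoords-pointwise R hA hB = ++-pointwise R
    (λ t → let i = proj₁ (remQuot {d₂} (triangle k) t) ; ab = upperIndex k (proj₂ (remQuot {d₂} (triangle k) t)) in hA i (proj₁ ab) (proj₂ ab))
    (λ t → let i = proj₁ (remQuot {d₃} (strictTriangle k) t) ; ab = strictUpperIndex k (proj₂ (remQuot {d₃} (strictTriangle k) t)) in hB i (proj₁ ab) (proj₂ ab))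

  quadCoords-pointwise₃ : (R : F → F → F → Set) → ∀ {A A′ A″ B B′ B″} →
                          (∀ i a b → R (A i a b) (A′ i a b) (A″ i a b)) → (∀ i a b → R (B i a b) (B′ i a b) (B″ i a b)) →
                          ∀ t → R (quadCoords A B t) (quadCoords A′ B′ t) (quadCoords A″ B″ t)
  quadCoords-pointwise₃ R hA hB = ++-pointwise₃ R
    (λ t → let i = proj₁ (remQuot {d₂} (triangle k) t) ; ab = upperIndex k (proj₂ (remQuot {d₂} (triangle k) t)) in hA i (proj₁ ab) (proj₂ ab))
    (λ t → let i = proj₁ (remQuot {d₃} (strictTriangle k) t) ; ab = strictUpperIndex k (proj₂ (remQuot {d₃} (strictTriangle k) t)) in hB i (proj₁ ab) (proj₂ ab))

  hits⇒coords≗target : ∀ v U V X → Hits 𝔅 v U V X → coords X ≗ targetCoords v U V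
  hits⇒coords≗target v U V X (hv , hU , hV) = ++-pointwise _≡_ (flatten-pointwise _≡_ (λ i a → matVec X (r i) a) v hv) (quadCoords-pointwise _≡_ hU hV)

  coords≗target⇒hits : ∀ v U V X → (∀ i → Symmetric (U i)) → (∀ i → SkewSymmetric (V i)) →
                       coords X ≗ targetCoords v U V → Hits 𝔅 v U V X
  coords≗target⇒hits v U V X sU sV eq = hv , hU , hV
    where
    outer = ++-split _≡_ _ _ _ _ eq
    inner = ++-split _≡_ _ _ _ _ (proj₂ outer)
    hv : ∀ i a → matVec X (r i) a ≡ v i a
    hv i a = trans (sym (flatten-combine (λ i a → matVec X (r i) a) i a)) (trans (proj₁ outer (combine i a)) (flatten-combine v i a))
    hU : ∀ i a b → quadForm X (Ms i) a b ≡ U i a b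
    hU i = upper-injective k _ (U i) (quadForm-symmetric X (Ms i) (sym-symmetric i)) (sU i)
             (λ t → trans (sym (flatten-combine (λ i → upper k (quadForm X (Ms i))) i t))
                          (trans (proj₁ inner (combine i t)) (flatten-combine (λ i → upper k (U i)) i t)))
    hV : ∀ i a b → quadForm X (Ns i) a b ≡ V i a b
    hV i = strictUpper-injective p-prime p≢2 k _ (V i) (quadForm-skew X (Ns i) (skew-skew i)) (sV i)
             (λ t → trans (sym (flatten-combine (λ i → strictUpper k (quadForm X (Ns i))) i t))
                          (trans (proj₂ inner (combine i t)) (flatten-combine (λ i → strictUpper k (V i)) i t)))

  Φ : Vect N → Vect m
  Φ x = coords (unflatten x)

  Φ-cong : ∀ {x y} → x ≗ y → Φ x ≗ Φ y
  Φ-cong {x} {y} eq = ++-pointwise _≡_ (flatten-pointwise _≡_ (λ i → matVec (unflatten x) (r i)) (λ i → matVec (unflatten y) (r i))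
                                         (λ i → matVec-cong (λ a j → eq (combine a j)) (r i)))
                (quadCoords-pointwise _≡_ (λ i → quadForm-cong (λ a j → eq (combine a j)) (Ms i))
                                          (λ i → quadForm-cong (λ a j → eq (combine a j)) (Ns i)))

  linCoords : Vect N → Vect m₁
  linCoords h = flatten (λ i a → matVec (unflatten h) (r i) a)

  polarCoord : Vect N → Fin m₂ → Vect N → F
  polarCoord h c x = quadCoords (λ i → polar (unflatten x) (unflatten h) (Ms i)) (λ i → polar (unflatten x) (unflatten h) (Ns i)) c

  quadCoord : Vect N → Vect m₂
  quadCoord h = quadCoords (λ i → quadForm (unflatten h) (Ms i)) (λ i → quadForm (unflatten h) (Ns i))

  quadCoords-+ : ∀ A A′ B B′ → quadCoords (λ i a b → A i a b ⊕ A′ i a b) (λ i a b → B i a b ⊕ B′ i a b) ≗ quadCoords A B +V quadCoords A′ B′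
  quadCoords-+ A A′ B B′ = quadCoords-pointwise₃ (λ a b c → a ≡ b ⊕ c) {A′ = A} {A″ = A′} {B′ = B} {B″ = B′}
                             (λ _ _ _ → refl) (λ _ _ _ → refl)

  Φ-+ : ∀ x h → Φ (x +V h) ≗ Φ x +V (linCoords h ++ (λ c → polarCoord h c x ⊕ quadCoord h c))
  Φ-+ x h = ++-pointwise₃ (λ a b c → a ≡ b ⊕ c) {u″ = linCoords h} {w″ = λ c → polarCoord h c x ⊕ quadCoord h c}
              (λ t → matVec-+ X H (r (proj₁ (remQuot {d₁} k t))) (proj₂ (remQuot {d₁} k t))) quadratic-part
    where
    X = unflatten x
    H = unflatten h
    quadratic-part : ∀ c → quadCoords (λ i → quadForm (X +M H) (Ms i)) (λ i → quadForm (X +M H) (Ns i)) c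
                           ≡ quadCoords (λ i → quadForm X (Ms i)) (λ i → quadForm X (Ns i)) c ⊕ (polarCoord h c x ⊕ quadCoord h c)
    quadratic-part c = trans (quadCoords-pointwise _≡_
        {A′ = λ i a b → quadForm X (Ms i) a b ⊕ (polar X H (Ms i) a b ⊕ quadForm H (Ms i) a b)}
        {B′ = λ i a b → quadForm X (Ns i) a b ⊕ (polar X H (Ns i) a b ⊕ quadForm H (Ns i) a b)}
        (λ i → quadForm-+ X H (Ms i)) (λ i → quadForm-+ X H (Ns i)) c)
      (trans (quadCoords-+ (λ i → quadForm X (Ms i)) (λ i a b → polar X H (Ms i) a b ⊕ quadForm H (Ms i) a b)
                           (λ i → quadForm X (Ns i)) (λ i a b → polar X H (Ns i) a b ⊕ quadForm H (Ns i) a b) c)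
             (cong (quadCoords (λ i → quadForm X (Ms i)) (λ i → quadForm X (Ns i)) c ⊕_) (quadCoords-+ (λ i → polar X H (Ms i)) (λ i → quadForm H (Ms i)) (λ i → polar X H (Ns i)) (λ i → quadForm H (Ns i)) c)))

  collision⇒ : ∀ x h → Φ (x +V h) ≗ Φ x → (∀ c → linCoords h c ≡ 0F) × (∀ c → polarCoord h c x ≡ ⊝ quadCoord h c)
  collision⇒ x h eq = proj₁ parts , λ c → +-inverseʳ-unique (quadCoord h c) _ (trans (+-comm (quadCoord h c) (polarCoord h c x)) (proj₂ parts c))
    where
    difference≡0 : ∀ t → (linCoords h ++ (λ c → polarCoord h c x ⊕ quadCoord h c)) t ≡ 0F
    difference≡0 t = +-identityʳ-unique (Φ x t) _ (trans (sym (Φ-+ x h t)) (eq t))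
    parts = ++-split (λ a _ → a ≡ 0F) _ (λ _ → 0F) _ (λ _ → 0F) difference≡0

  linCoords≡0? : ∀ h → Dec (∀ c → linCoords h c ≡ 0F)
  linCoords≡0? h = all? (λ c → linCoords h c Fin.≟ 0F)

  polarEquation? : ∀ h x → Dec (∀ c → polarCoord h c x ≡ ⊝ quadCoord h c)
  polarEquation? h x = all? (λ c → polarCoord h c x Fin.≟ ⊝ quadCoord h c)

  𝟙-collision≤ : ∀ x h → 𝟙 (Φ (x +V h) ≟V Φ x) ≤ 𝟙 (linCoords≡0? h) ℕ.* 𝟙 (polarEquation? h x)
  𝟙-collision≤ x h = 𝟙-× (Φ (x +V h) ≟V Φ x) (linCoords≡0? h) (polarEquation? h x) (collision⇒ x h)

  linCoord-isLinear : ∀ c → IsLinear (λ h → linCoords h c)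
  linCoord-isLinear c = record
    { ⊕-homo = λ u w → matVec-+ (unflatten u) (unflatten w) (r i) a
    ; ·-homo = λ s u → matVec-· s (unflatten u) (r i) a
    ; ≗-cong = λ eq → matVec-cong (λ a j → eq (combine a j)) (r i) a }
    where
    i = proj₁ (remQuot {d₁} k c)
    a = proj₂ (remQuot {d₁} k c)

  linCoord-independent : LinIndep r → Independent (λ c h → linCoords h c)
  linCoord-independent independent μ H c =
    subst (λ z → μ z ≡ 0F) (combine-remQuot {d₁} k c) (independent (λ i → μ (combine i a₀)) column≡0 i₀)
    where
    i₀ = proj₁ (remQuot {d₁} k c)
    a₀ = proj₂ (remQuot {d₁} k c)
    column≡0 : ∀ j₀ → sumF d₁ (λ i → μ (combine i a₀) ⊗ r i j₀) ≡ 0F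
    column≡0 j₀ = trans (sym evaluate) (H (basis (combine a₀ j₀)))
      where
      e = basis (combine a₀ j₀)
      evaluate : dot μ (linCoords e) ≡ sumF d₁ (λ i → μ (combine i a₀) ⊗ r i j₀)
      evaluate = trans (dot-flatten d₁ k μ _) (sumF-cong d₁ (λ i → trans
        (sumF-cong k (λ a → trans (sym (sumF-*ˡ n (μ (combine i a)) _)) (sumF-cong n (λ j →
          solve 3 (λ μ x r → μ :* (x :* r) := x :* (r :* μ)) refl (μ (combine i a)) (e (combine a j)) (r i j)))))
        (trans (sumF₂-basis k n a₀ j₀ (λ a j → r i j ⊗ μ (combine i a))) (*-comm (r i j₀) (μ (combine i a₀))))))

  linearKernel*p^m₁≤p^N : LinIndep r → kernelSize N (λ c h → linCoords h c) ℕ.* p ^ m₁ ≤ p ^ N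
  linearKernel*p^m₁≤p^N independent = kernelSize*p^s≤p^N N m₁ _ linCoord-isLinear (linCoord-independent independent)

  polarCoord-isLinear : ∀ h c → IsLinear (polarCoord h c)
  polarCoord-isLinear h c = record
    { ⊕-homo = λ u w → quadCoords-pointwise₃ (λ a b c → a ≡ b ⊕ c)
                         {A″ = λ i → polar (unflatten w) H (Ms i)} {B″ = λ i → polar (unflatten w) H (Ns i)}
                         (λ i → polar-+ˡ (unflatten u) (unflatten w) H (Ms i)) (λ i → polar-+ˡ (unflatten u) (unflatten w) H (Ns i)) c
    ; ·-homo = λ s u → quadCoords-pointwise (λ a b → a ≡ s ⊗ b)
                         {A′ = λ i → polar (unflatten u) H (Ms i)} {B′ = λ i → polar (unflatten u) H (Ns i)}
                         (λ i → polar-·ˡ s (unflatten u) H (Ms i)) (λ i → polar-·ˡ s (unflatten u) H (Ns i)) c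
    ; ≗-cong = λ eq → quadCoords-pointwise _≡_
                         (λ i → polar-cong (λ a j → eq (combine a j)) H (Ms i)) (λ i → polar-cong (λ a j → eq (combine a j)) H (Ns i)) c }
    where H = unflatten h

  fibre : Vect m → ℕ
  fibre t = vsum N (λ x → 𝟙 (Φ x ≟V t))

  hitCount≡fibre : ∀ v U V → (∀ i → Symmetric (U i)) → (∀ i → SkewSymmetric (V i)) →
                   List.length (List.filter (hits? 𝔅 v U V) (allMats k n)) ≡ fibre (targetCoords v U V)
  hitCount≡fibre v U V sU sV = begin
    List.length (List.filter (hits? 𝔅 v U V) (allMats k n))
      ≡⟨ length-filter≡listSum (hits? 𝔅 v U V) (allMats k n) ⟩
    listSum (allMats k n) (λ X → 𝟙 (hits? 𝔅 v U V X))
      ≡⟨ listSum-allMats k n _ (λ {X} {Y} eq → 𝟙-cong (hits? 𝔅 v U V X) (hits? 𝔅 v U V Y) (hits-cong eq) (hits-cong (λ a j → sym (eq a j)))) ⟩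
    vsum N (λ x → 𝟙 (hits? 𝔅 v U V (unflatten x)))
      ≡⟨ vsum-cong N (λ x → 𝟙-cong (hits? 𝔅 v U V _) (Φ x ≟V _) (hits⇒coords≗target v U V _) (coords≗target⇒hits v U V _ sU sV)) ⟩
    fibre (targetCoords v U V)
      ∎
    where
    open ≡-Reasoning
    hits-cong : ∀ {X Y} → X ≈M Y → Hits 𝔅 v U V X → Hits 𝔅 v U V Y
    hits-cong eq (hv , hU , hV) = (λ i a → trans (sym (matVec-cong eq (r i) a)) (hv i a)) ,
                                  (λ i a b → trans (sym (quadForm-cong eq (Ms i) a b)) (hU i a b)) ,
                                  (λ i a b → trans (sym (quadForm-cong eq (Ns i) a b)) (hV i a b))

  -- A dependency μ among the polar coordinates, read as coefficient matrices on the triangles.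
  symDual : Vect m₂ → Fin d₂ → Mat k k
  symDual μ i = fromUpper k (λ t → μ (combine i t ↑ˡ (d₃ ℕ.* strictTriangle k)))

  skewDual : Vect m₂ → Fin d₃ → Mat k k
  skewDual μ i = fromStrictUpper k (λ t → μ ((d₂ ℕ.* triangle k) ↑ʳ combine i t))

  sumF₃ : ∀ d → (Fin d → Mat k k) → F
  sumF₃ d f = sumF d (λ i → sumF k (λ a → sumF k (λ b → f i a b)))

  dot-quadCoords : ∀ μ A B → dot μ (quadCoords A B) ≡ sumF₃ d₂ (λ i a b → symDual μ i a b ⊗ A i a b) ⊕ sumF₃ d₃ (λ i a b → skewDual μ i a b ⊗ B i a b)
  dot-quadCoords μ A B = trans (dot-++ (d₂ ℕ.* triangle k) (d₃ ℕ.* strictTriangle k) μ _ _)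
    (cong₂ _⊕_ (trans (dot-flatten d₂ (triangle k) (λ c → μ (c ↑ˡ (d₃ ℕ.* strictTriangle k))) (λ i → upper k (A i))) (sumF-cong d₂ (λ i → dot-upper k _ (A i))))
               (trans (dot-flatten d₃ (strictTriangle k) (λ c → μ ((d₂ ℕ.* triangle k) ↑ʳ c)) (λ i → strictUpper k (B i))) (sumF-cong d₃ (λ i → dot-strictUpper k _ (B i)))))

  E : Fin k → Fin n → Vect N
  E a₀ j₀ = basis (combine a₀ j₀)

  symCoeff : Vect m₂ → Fin k → Fin k → Fin d₂ → F
  symCoeff μ a₀ b i = symDual μ i a₀ b ⊕ symDual μ i b a₀

  skewCoeff : Vect m₂ → Fin k → Fin k → Fin d₃ → F
  skewCoeff μ a₀ b i = skewDual μ i a₀ b ⊕ ⊝ skewDual μ i b a₀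

  dualComb : Vect m₂ → Vect N → Vect N → F
  dualComb μ h x = dot μ (λ c → polarCoord h c x)

  rowValue : Vect m₂ → Vect N → Fin k → Fin n → F
  rowValue μ h a₀ j₀ = sumF d₂ (λ i → sumF k (λ b → symCoeff μ a₀ b i ⊗ mulᵀ (Ms i) (unflatten h) j₀ b))
                     ⊕ sumF d₃ (λ i → sumF k (λ b → skewCoeff μ a₀ b i ⊗ mulᵀ (Ns i) (unflatten h) j₀ b))

  dualComb-E : ∀ μ h a₀ j₀ → dualComb μ h (E a₀ j₀) ≡ rowValue μ h a₀ j₀
  dualComb-E μ h a₀ j₀ = trans (dot-quadCoords μ (λ i → polar X H (Ms i)) (λ i → polar X H (Ns i)))
                               (cong₂ _⊕_ (sumF-cong d₂ symmetric-part) (sumF-cong d₃ skew-part))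
    where
    X = unflatten (E a₀ j₀)
    H = unflatten h
    symmetric-part : ∀ i → sumF k (λ a → sumF k (λ b → symDual μ i a b ⊗ polar X H (Ms i) a b))
                           ≡ sumF k (λ b → symCoeff μ a₀ b i ⊗ mulᵀ (Ms i) H j₀ b)
    symmetric-part i = begin
      sumF k (λ a → sumF k (λ b → S a b ⊗ polar X H (Ms i) a b))
        ≡⟨ sumF-cong k (λ a → sumF-cong k (λ b → cong (S a b ⊗_) (polar-basis H (Ms i) a₀ j₀ a b))) ⟩
      sumF k (λ a → sumF k (λ b → S a b ⊗ (basis a₀ a ⊗ mulᵀ (Ms i) H j₀ b ⊕ basis a₀ b ⊗ mul H (Ms i) a j₀)))
        ≡⟨ sumF₂-basis-row-column S (mulᵀ (Ms i) H j₀) (λ a → mul H (Ms i) a j₀) a₀ ⟩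
      sumF k (λ b → S a₀ b ⊗ mulᵀ (Ms i) H j₀ b) ⊕ sumF k (λ a → S a a₀ ⊗ mul H (Ms i) a j₀)
        ≡⟨ cong (sumF k (λ b → S a₀ b ⊗ mulᵀ (Ms i) H j₀ b) ⊕_) (sumF-cong k (λ a → cong (S a a₀ ⊗_) (mul-symmetric H (Ms i) (sym-symmetric i) a j₀))) ⟩
      sumF k (λ b → S a₀ b ⊗ mulᵀ (Ms i) H j₀ b) ⊕ sumF k (λ b → S b a₀ ⊗ mulᵀ (Ms i) H j₀ b)
        ≡⟨ trans (sumF-cong k (λ b → distribʳ (mulᵀ (Ms i) H j₀ b) (S a₀ b) (S b a₀))) (sumF-+ k _ _) ⟨
      sumF k (λ b → symCoeff μ a₀ b i ⊗ mulᵀ (Ms i) H j₀ b)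
        ∎
      where
      open ≡-Reasoning
      S = symDual μ i
    skew-part : ∀ i → sumF k (λ a → sumF k (λ b → skewDual μ i a b ⊗ polar X H (Ns i) a b))
                      ≡ sumF k (λ b → skewCoeff μ a₀ b i ⊗ mulᵀ (Ns i) H j₀ b)
    skew-part i = begin
      sumF k (λ a → sumF k (λ b → T a b ⊗ polar X H (Ns i) a b))
        ≡⟨ sumF-cong k (λ a → sumF-cong k (λ b → cong (T a b ⊗_) (polar-basis H (Ns i) a₀ j₀ a b))) ⟩
      sumF k (λ a → sumF k (λ b → T a b ⊗ (basis a₀ a ⊗ mulᵀ (Ns i) H j₀ b ⊕ basis a₀ b ⊗ mul H (Ns i) a j₀)))
        ≡⟨ sumF₂-basis-row-column T (mulᵀ (Ns i) H j₀) (λ a → mul H (Ns i) a j₀) a₀ ⟩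
      sumF k (λ b → T a₀ b ⊗ mulᵀ (Ns i) H j₀ b) ⊕ sumF k (λ a → T a a₀ ⊗ mul H (Ns i) a j₀)
        ≡⟨ cong (sumF k (λ b → T a₀ b ⊗ mulᵀ (Ns i) H j₀ b) ⊕_) (sumF-cong k (λ a → trans (cong (T a a₀ ⊗_) (mul-skew H (Ns i) (skew-skew i) a j₀))
                                                (trans (sym (-‿distribʳ-* (T a a₀) (mulᵀ (Ns i) H j₀ a))) (-‿distribˡ-* (T a a₀) (mulᵀ (Ns i) H j₀ a))))) ⟩
      sumF k (λ b → T a₀ b ⊗ mulᵀ (Ns i) H j₀ b) ⊕ sumF k (λ b → ⊝ T b a₀ ⊗ mulᵀ (Ns i) H j₀ b)
        ≡⟨ trans (sumF-cong k (λ b → distribʳ (mulᵀ (Ns i) H j₀ b) (T a₀ b) (⊝ T b a₀))) (sumF-+ k _ _) ⟨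
      sumF k (λ b → skewCoeff μ a₀ b i ⊗ mulᵀ (Ns i) H j₀ b)
        ∎
      where
      open ≡-Reasoning
      T = skewDual μ i

  rowFunctional : Vect m₂ → Fin k → Fin n → Vect N → F
  rowFunctional μ a₀ j₀ = matrixDot k n (λ b m → linComb 𝔅 (symCoeff μ a₀ b) (skewCoeff μ a₀ b) j₀ m)

  rowFunctional≡rowValue : ∀ μ a₀ j₀ h → rowFunctional μ a₀ j₀ h ≡ rowValue μ h a₀ j₀
  rowFunctional≡rowValue μ a₀ j₀ h = trans (sumF-cong k (λ b → sumF-cong n (λ m → expand b m)))
    (trans (sumF₂-+ k n _ _) (cong₂ _⊕_ (regroup d₂ (symCoeff μ a₀) Ms) (regroup d₃ (skewCoeff μ a₀) Ns)))
    where
    regroup : ∀ d (c : Fin k → Fin d → F) (Ks : Fin d → Mat n n) →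
              sumF k (λ b → sumF n (λ m → sumF d (λ i → c b i ⊗ (Ks i j₀ m ⊗ h (combine b m)))))
              ≡ sumF d (λ i → sumF k (λ b → c b i ⊗ mulᵀ (Ks i) (unflatten h) j₀ b))
    regroup d c Ks = trans (sumF-cong k (λ b → sumF-comm n d _))
                           (trans (sumF-comm k d _) (sumF-cong d (λ i → sumF-cong k (λ b → sumF-*ˡ n (c b i) _))))
    expand : ∀ b m → linComb 𝔅 (symCoeff μ a₀ b) (skewCoeff μ a₀ b) j₀ m ⊗ h (combine b m)
                     ≡ sumF d₂ (λ i → symCoeff μ a₀ b i ⊗ (Ms i j₀ m ⊗ h (combine b m)))
                       ⊕ sumF d₃ (λ i → skewCoeff μ a₀ b i ⊗ (Ns i j₀ m ⊗ h (combine b m)))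
    expand b m = trans (distribʳ x (sumF d₂ (λ i → α i ⊗ Ms i j₀ m)) (sumF d₃ (λ i → β i ⊗ Ns i j₀ m)))
      (cong₂ _⊕_ (trans (sym (sumF-*ʳ d₂ x (λ i → α i ⊗ Ms i j₀ m))) (sumF-cong d₂ (λ i → *-assoc (α i) (Ms i j₀ m) x)))
                 (trans (sym (sumF-*ʳ d₃ x (λ i → β i ⊗ Ns i j₀ m))) (sumF-cong d₃ (λ i → *-assoc (β i) (Ns i j₀ m) x))))
      where
      x = h (combine b m)
      α = symCoeff μ a₀ b
      β = skewCoeff μ a₀ b

  dualComb≡0⇒rowFunctional≡0 : ∀ μ h a₀ → (∀ x → dualComb μ h x ≡ 0F) → ∀ j₀ → rowFunctional μ a₀ j₀ h ≡ 0F
  dualComb≡0⇒rowFunctional≡0 μ h a₀ H j₀ = trans (rowFunctional≡rowValue μ a₀ j₀ h) (trans (sym (dualComb-E μ h a₀ j₀)) (H (E a₀ j₀)))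

  dualComb≡0? : ∀ μ h → Dec (∀ x → dualComb μ h x ≡ 0F)
  dualComb≡0? μ h = ∀V? N (λ x → dualComb μ h x Fin.≟ 0F)
    (λ eq z → trans (sumF-cong m₂ (λ c → cong (μ c ⊗_) (≗-cong (polarCoord-isLinear h c) (λ i → sym (eq i))))) z)

  private
    allZero? : ∀ d (f : Fin d → Mat k k) → Dec (∀ i a b → f i a b ≡ 0F)
    allZero? d f = all? (λ i → all? (λ a → all? (λ b → f i a b Fin.≟ 0F)))

    nonzeroEntry : ∀ d (f : Fin d → Mat k k) → ¬ (∀ i a b → f i a b ≡ 0F) → Σ (Fin d) λ i → Σ (Fin k) λ a → Σ (Fin k) λ b → f i a b ≢ 0F
    nonzeroEntry d f ne with ¬∀⟶∃¬ d _ (λ i → all? (λ a → all? (λ b → f i a b Fin.≟ 0F))) ne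
    ... | i , ne₁ with ¬∀⟶∃¬ k _ (λ a → all? (λ b → f i a b Fin.≟ 0F)) ne₁
    ... | a , ne₂ with ¬∀⟶∃¬ k _ (λ b → f i a b Fin.≟ 0F) ne₂
    ... | b , ne₃ = i , a , b , ne₃

  duals≡0⇒≡0 : ∀ μ → (∀ i a b → symDual μ i a b ≡ 0F) → (∀ i a b → skewDual μ i a b ≡ 0F) → ∀ c → μ c ≡ 0F
  duals≡0⇒≡0 μ zS zT c with splitAt-cases (d₂ ℕ.* triangle k) (d₃ ℕ.* strictTriangle k) c
  ... | inj₁ (c₁ , refl) = subst (λ z → μ (z ↑ˡ (d₃ ℕ.* strictTriangle k)) ≡ 0F) (combine-remQuot {d₂} (triangle k) c₁)
                                 (fromUpper-zero k _ (zS i) t)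
    where
    i = proj₁ (remQuot {d₂} (triangle k) c₁)
    t = proj₂ (remQuot {d₂} (triangle k) c₁)
  ... | inj₂ (c₂ , refl) = subst (λ z → μ ((d₂ ℕ.* triangle k) ↑ʳ z) ≡ 0F) (combine-remQuot {d₃} (strictTriangle k) c₂)
                                 (fromStrictUpper-zero k _ (zT i) t)
    where
    i = proj₁ (remQuot {d₃} (strictTriangle k) c₂)
    t = proj₂ (remQuot {d₃} (strictTriangle k) c₂)

  -- Since the dual matrices are supported on the (strict) upper triangle, a nonzero entry
  -- survives symmetrisation: this is where p ≠ 2 enters.
  nonzeroCoefficients : ∀ μ → ¬ (∀ c → μ c ≡ 0F) →
    Σ (Fin k) λ a₀ → Σ (Fin k) λ b₀ → ¬ ((∀ i → symCoeff μ a₀ b₀ i ≡ 0F) × (∀ i → skewCoeff μ a₀ b₀ i ≡ 0F))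
  nonzeroCoefficients μ μ≢0 with allZero? d₂ (symDual μ)
  ... | no S≢0 with nonzeroEntry d₂ (symDual μ) S≢0
  ... | i , a , b , Sab≢0 = a , b , λ z → symCoeff≢0 (proj₁ z i)
    where
    open FpField p p-prime using (x+x≡0⇒x≡0)
    symCoeff≢0 : symCoeff μ a b i ≢ 0F
    symCoeff≢0 e with a Fin.≟ b
    ... | yes refl = Sab≢0 (x+x≡0⇒x≡0 p≢2 (symDual μ i a a) e)
    ... | no a≢b  = Sab≢0 (trans (sym (+-identityʳ _)) (trans (cong (symDual μ i a b ⊕_) (sym (fromUpper-upper k _ a b Sab≢0 a≢b))) e))
  nonzeroCoefficients μ μ≢0 | yes S≡0 with allZero? d₃ (skewDual μ)
  ... | yes T≡0 = ⊥-elim (μ≢0 (duals≡0⇒≡0 μ S≡0 T≡0))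
  ... | no T≢0 with nonzeroEntry d₃ (skewDual μ) T≢0
  ... | i , a , b , Tab≢0 = a , b , λ z → skewCoeff≢0 (proj₂ z i)
    where
    skewCoeff≢0 : skewCoeff μ a b i ≢ 0F
    skewCoeff≢0 e = Tab≢0 (trans (sym (+-identityʳ _))
                       (trans (cong (skewDual μ i a b ⊕_) (sym (trans (cong ⊝_ (fromStrictUpper-upper k _ a b Tab≢0)) -0#≈0#))) e))

  degenerate*p^r≤p^N : ∀ r → ((a : Fin d₂ → F) (b : Fin d₃ → F) → ¬ ((∀ i → a i ≡ 0F) × (∀ j → b j ≡ 0F)) → RankAtLeast r (linComb 𝔅 a b)) →
                       ∀ μ → ¬ (∀ c → μ c ≡ 0F) → vsum N (λ h → 𝟙 (dualComb≡0? μ h)) ℕ.* p ^ r ≤ p ^ N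
  degenerate*p^r≤p^N r rank μ μ≢0 =
    ℕP.≤-trans (ℕP.*-monoˡ-≤ (p ^ r) (vsum-mono-≤ N (λ h → 𝟙-mono (dualComb≡0? μ h) (inKernel? ψ h) (λ z i → dualComb≡0⇒rowFunctional≡0 μ h a₀ z (rows i)))))
               (kernelSize*p^s≤p^N N r ψ (λ i → isLinear-matrixDot k n (λ b m → linComb 𝔅 (symCoeff μ a₀ b) (skewCoeff μ a₀ b) (rows i) m))
                                   ψ-independent)
    where
    a₀ = proj₁ (nonzeroCoefficients μ μ≢0)
    b₀ = proj₁ (proj₂ (nonzeroCoefficients μ μ≢0))
    rk = rank (symCoeff μ a₀ b₀) (skewCoeff μ a₀ b₀) (proj₂ (proj₂ (nonzeroCoefficients μ μ≢0)))
    rows = proj₁ rk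
    ψ : Fin r → Vect N → F
    ψ i = rowFunctional μ a₀ (rows i)
    -- Evaluating at E b₀ m₀ picks out the (rows i, m₀) entries of Σ aᵢ Mᵢ + Σ bⱼ Nⱼ.
    ψ-independent : Independent ψ
    ψ-independent ν H = proj₂ rk ν (λ m₀ → trans
      (sumF-cong r (λ i → cong (ν i ⊗_) (sym (matrixDot-basis k n (λ b m → linComb 𝔅 (symCoeff μ a₀ b) (skewCoeff μ a₀ b) (rows i) m) b₀ m₀))))
      (H (E b₀ m₀)))

-- Collisions and the second moment

module SecondMoment (p : ℕ) .{{_ : NonZero p}} (p-prime : Prime p) (p≢2 : p ≢ 2)
                    (k : ℕ) {n d₁ d₂ d₃ : ℕ} (𝔅 : Fp.QFactor p n d₁ d₂ d₃) (r : ℕ) (hasRank : Fp.FactorRankAtLeast p r 𝔅) where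
  open Fp p
  open FpRing p
  open Counting p
  open LinearFunctionals p p-prime
  open FactorCoordinates p p-prime p≢2 k 𝔅

  collisions : ℕ
  collisions = vsum N (λ x → vsum N (λ y → 𝟙 (Φ y ≟V Φ x)))

  shiftCollisions : Vect N → ℕ
  shiftCollisions h = vsum N (λ x → 𝟙 (Φ (x +V h) ≟V Φ x))

  collisions≡ : collisions ≡ vsum N shiftCollisions
  collisions≡ = trans (vsum-cong N (λ x → sym (vsum-translate N (extensional x) x))) (vsum-comm N N _)
    where
    extensional : ∀ x → Extensional (λ y → 𝟙 (Φ y ≟V Φ x))
    extensional x eq = 𝟙-cong (_ ≟V _) (_ ≟V _) (λ z t → trans (sym (Φ-cong eq t)) (z t)) (λ z t → trans (Φ-cong eq t) (z t))

  nonzero? : ∀ (μ : Vect m₂) → Dec (¬ (∀ c → μ c ≡ 0F))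
  nonzero? μ = ¬? (all? (λ c → μ c Fin.≟ 0F))

  degenerate? : ∀ μ h → Dec ((¬ (∀ c → μ c ≡ 0F)) × (∀ x → dualComb μ h x ≡ 0F))
  degenerate? μ h = nonzero? μ ×-dec dualComb≡0? μ h

  degenerateDuals : Vect N → ℕ
  degenerateDuals h = vsum m₂ (λ μ → 𝟙 (degenerate? μ h))

  -- Without degenerate dual vectors the polar functionals are independent.
  polarKernel-bound : ∀ h → kernelSize N (polarCoord h) ℕ.* p ^ m₂ ≤ p ^ N ℕ.+ degenerateDuals h ℕ.* (p ^ N ℕ.* p ^ m₂)
  polarKernel-bound h with degenerateDuals h in eq
  ... | suc d = ℕP.≤-trans (ℕP.*-monoˡ-≤ (p ^ m₂) (kernelSize≤p^N N (polarCoord h)))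
                  (ℕP.≤-trans (ℕP.m≤m+n _ (d ℕ.* (p ^ N ℕ.* p ^ m₂))) (ℕP.m≤n+m _ (p ^ N)))
  ... | zero  = ℕP.≤-trans (kernelSize*p^s≤p^N N m₂ (polarCoord h) (polarCoord-isLinear h) independent) (ℕP.m≤m+n (p ^ N) 0)
    where
    extensional : Extensional (λ μ → 𝟙 (degenerate? μ h))
    extensional {μ} {μ′} eq = 𝟙-cong (degenerate? μ h) (degenerate? μ′ h)
      (λ (μ≢0 , z) → (λ μ′≡0 → μ≢0 (λ c → trans (eq c) (μ′≡0 c))) , λ x → trans (sumF-cong m₂ (λ c → cong (_⊗ polarCoord h c x) (sym (eq c)))) (z x))
      (λ (μ′≢0 , z) → (λ μ≡0 → μ′≢0 (λ c → trans (sym (eq c)) (μ≡0 c))) , λ x → trans (sumF-cong m₂ (λ c → cong (_⊗ polarCoord h c x) (eq c))) (z x))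
    independent : Independent (polarCoord h)
    independent μ H with all? (λ c → μ c Fin.≟ 0F)
    ... | yes μ≡0 = μ≡0
    ... | no μ≢0  = ⊥-elim (ℕP.<⇒≱ (s≤s z≤n) (ℕP.≤-trans (ℕP.≤-reflexive (sym (𝟙-yes (degenerate? μ h) (μ≢0 , H))))
                                                         (ℕP.≤-trans (≤-vsum m₂ extensional μ) (ℕP.≤-reflexive eq))))

  shiftCollisions-bound : ∀ h → shiftCollisions h ℕ.* p ^ m₂ ≤ 𝟙 (linCoords≡0? h) ℕ.* p ^ N ℕ.+ degenerateDuals h ℕ.* (p ^ N ℕ.* p ^ m₂)
  shiftCollisions-bound h = begin
    shiftCollisions h ℕ.* p ^ m₂
      ≤⟨ ℕP.*-monoˡ-≤ (p ^ m₂) (ℕP.≤-trans (vsum-mono-≤ N (λ x → 𝟙-collision≤ x h)) (ℕP.≤-reflexive (vsum-*ˡ N L _))) ⟩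
    L ℕ.* vsum N (λ x → 𝟙 (polarEquation? h x)) ℕ.* p ^ m₂
      ≤⟨ ℕP.*-monoˡ-≤ (p ^ m₂) (ℕP.*-monoʳ-≤ L (solutions≤kernelSize N (polarCoord h) (λ c → ⊝ quadCoord h c) (polarCoord-isLinear h))) ⟩
    L ℕ.* kernelSize N (polarCoord h) ℕ.* p ^ m₂
      ≡⟨ ℕP.*-assoc L _ _ ⟩
    L ℕ.* (kernelSize N (polarCoord h) ℕ.* p ^ m₂)
      ≤⟨ ℕP.*-monoʳ-≤ L (polarKernel-bound h) ⟩
    L ℕ.* (p ^ N ℕ.+ degenerateDuals h ℕ.* (p ^ N ℕ.* p ^ m₂))
      ≡⟨ ℕP.*-distribˡ-+ L _ _ ⟩
    L ℕ.* p ^ N ℕ.+ L ℕ.* (degenerateDuals h ℕ.* (p ^ N ℕ.* p ^ m₂))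
      ≤⟨ ℕP.+-monoʳ-≤ (L ℕ.* p ^ N) (ℕP.≤-trans (ℕP.*-monoˡ-≤ _ (𝟙≤1 (linCoords≡0? h))) (ℕP.≤-reflexive (ℕP.*-identityˡ _))) ⟩
    L ℕ.* p ^ N ℕ.+ degenerateDuals h ℕ.* (p ^ N ℕ.* p ^ m₂)
      ∎
    where
    open ℕP.≤-Reasoning
    L = 𝟙 (linCoords≡0? h)

  linearKernel : ℕ
  linearKernel = kernelSize N (λ c h → linCoords h c)

  totalDegenerate : ℕ
  totalDegenerate = vsum N degenerateDuals

  collisions*p^m₂≤ : collisions ℕ.* p ^ m₂ ≤ linearKernel ℕ.* p ^ N ℕ.+ totalDegenerate ℕ.* (p ^ N ℕ.* p ^ m₂)
  collisions*p^m₂≤ = begin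
    collisions ℕ.* p ^ m₂
      ≡⟨ trans (cong (ℕ._* p ^ m₂) collisions≡) (sym (vsum-*ʳ N (p ^ m₂) shiftCollisions)) ⟩
    vsum N (λ h → shiftCollisions h ℕ.* p ^ m₂)
      ≤⟨ vsum-mono-≤ N shiftCollisions-bound ⟩
    vsum N (λ h → 𝟙 (linCoords≡0? h) ℕ.* p ^ N ℕ.+ degenerateDuals h ℕ.* (p ^ N ℕ.* p ^ m₂))
      ≡⟨ vsum-distrib-+ N _ _ ⟩
    vsum N (λ h → 𝟙 (linCoords≡0? h) ℕ.* p ^ N) ℕ.+ vsum N (λ h → degenerateDuals h ℕ.* (p ^ N ℕ.* p ^ m₂))
      ≡⟨ cong₂ ℕ._+_ (vsum-*ʳ N (p ^ N) _) (vsum-*ʳ N (p ^ N ℕ.* p ^ m₂) degenerateDuals) ⟩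
    linearKernel ℕ.* p ^ N ℕ.+ totalDegenerate ℕ.* (p ^ N ℕ.* p ^ m₂)
      ∎
    where open ℕP.≤-Reasoning

  totalDegenerate*p^r≤ : totalDegenerate ℕ.* p ^ r ≤ p ^ m₂ ℕ.* p ^ N
  totalDegenerate*p^r≤ = begin
    totalDegenerate ℕ.* p ^ r
      ≡⟨ cong (ℕ._* p ^ r) (vsum-comm N m₂ _) ⟩
    vsum m₂ (λ μ → vsum N (λ h → 𝟙 (degenerate? μ h))) ℕ.* p ^ r
      ≡⟨ vsum-*ʳ m₂ (p ^ r) _ ⟨
    vsum m₂ (λ μ → vsum N (λ h → 𝟙 (degenerate? μ h)) ℕ.* p ^ r)
      ≤⟨ vsum-mono-≤ m₂ per-dual ⟩
    vsum m₂ (λ _ → p ^ N)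
      ≡⟨ vsum-const m₂ (p ^ N) ⟩
    p ^ m₂ ℕ.* p ^ N
      ∎
    where
    open ℕP.≤-Reasoning
    per-dual : ∀ μ → vsum N (λ h → 𝟙 (degenerate? μ h)) ℕ.* p ^ r ≤ p ^ N
    per-dual μ with nonzero? μ
    ... | no _    = ℕP.≤-trans (ℕP.≤-reflexive (cong (ℕ._* p ^ r) (trans (vsum-const N 0) (ℕP.*-zeroʳ (p ^ N))))) z≤n
    ... | yes μ≢0 = ℕP.≤-trans (ℕP.≤-reflexive (cong (ℕ._* p ^ r) (vsum-cong N (λ h →
                      𝟙-cong (yes μ≢0 ×-dec dualComb≡0? μ h) (dualComb≡0? μ h) proj₂ (μ≢0 ,_)))))
                      (degenerate*p^r≤p^N r (proj₂ hasRank) μ μ≢0)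

  p^m≡ : p ^ m ≡ p ^ m₁ ℕ.* p ^ m₂
  p^m≡ = ℕP.^-distribˡ-+-* p m₁ m₂

  collisions-bound : collisions ℕ.* p ^ m ℕ.* p ^ r ≤ p ^ N ℕ.* p ^ N ℕ.* p ^ r ℕ.+ p ^ N ℕ.* p ^ N ℕ.* p ^ m ℕ.* p ^ m₂
  collisions-bound rewrite p^m≡ = collisions-arithmetic collisions linearKernel totalDegenerate (p ^ N) (p ^ m₂) (p ^ m₁) (p ^ r)
    collisions*p^m₂≤ (linearKernel*p^m₁≤p^N (proj₁ hasRank)) totalDegenerate*p^r≤

  Σfibre≡p^N : vsum m fibre ≡ p ^ N
  Σfibre≡p^N = trans (vsum-comm m N _) (trans (vsum-cong N (λ x → vsum-𝟙≟V m (Φ x))) (trans (vsum-const N 1) (ℕP.*-identityʳ _)))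

  Σfibre²≡collisions : vsum m (λ t → fibre t ℕ.* fibre t) ≡ collisions
  Σfibre²≡collisions = begin
    vsum m (λ t → fibre t ℕ.* fibre t)
      ≡⟨ vsum-cong m (λ t → trans (sym (vsum-*ʳ N (fibre t) _)) (vsum-cong N (λ x → sym (vsum-*ˡ N (𝟙 (Φ x ≟V t)) _)))) ⟩
    vsum m (λ t → vsum N (λ x → vsum N (λ y → 𝟙 (Φ x ≟V t) ℕ.* 𝟙 (Φ y ≟V t))))
      ≡⟨ trans (vsum-comm m N _) (vsum-cong N (λ x → vsum-comm m N _)) ⟩
    vsum N (λ x → vsum N (λ y → vsum m (λ t → 𝟙 (Φ x ≟V t) ℕ.* 𝟙 (Φ y ≟V t))))
      ≡⟨ vsum-cong N (λ x → vsum-cong N (λ y → vsum-𝟙≡ m (Φ x) (𝟙≟V-extensional (Φ y)))) ⟩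
    collisions
      ∎
    where open ≡-Reasoning

  deviation : Vect m → ℕ
  deviation t = ∣ fibre t ℕ.* p ^ m - p ^ N ∣

  Σdeviation²-identity : vsum m (λ t → deviation t ℕ.* deviation t) ℕ.+ 2 ℕ.* p ^ m ℕ.* p ^ N ℕ.* p ^ N
                         ≡ collisions ℕ.* (p ^ m ℕ.* p ^ m) ℕ.+ p ^ m ℕ.* (p ^ N ℕ.* p ^ N)
  Σdeviation²-identity = begin
    S ℕ.+ 2 ℕ.* P ℕ.* Q ℕ.* Q
      ≡⟨ cong (S ℕ.+_) (trans (cong (2 ℕ.* P ℕ.* Q ℕ.*_) (sym Σfibre≡p^N)) (trans (sym (vsum-*ˡ m (2 ℕ.* P ℕ.* Q) fibre)) (vsum-cong m (λ t → regroup₁ (fibre t) P Q)))) ⟩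
    S ℕ.+ vsum m (λ t → 2 ℕ.* (fibre t ℕ.* P ℕ.* Q))
      ≡⟨ vsum-distrib-+ m _ _ ⟨
    vsum m (λ t → deviation t ℕ.* deviation t ℕ.+ 2 ℕ.* (fibre t ℕ.* P ℕ.* Q))
      ≡⟨ vsum-cong m (λ t → ∣m-n∣²+2mn≡m²+n² (fibre t ℕ.* P) Q) ⟩
    vsum m (λ t → fibre t ℕ.* P ℕ.* (fibre t ℕ.* P) ℕ.+ Q ℕ.* Q)
      ≡⟨ vsum-distrib-+ m _ _ ⟩
    vsum m (λ t → fibre t ℕ.* P ℕ.* (fibre t ℕ.* P)) ℕ.+ vsum m (λ _ → Q ℕ.* Q)
      ≡⟨ cong₂ ℕ._+_ (trans (vsum-cong m (λ t → regroup₂ (fibre t) P)) (trans (vsum-*ˡ m (P ℕ.* P) _) (trans (cong (P ℕ.* P ℕ.*_) Σfibre²≡collisions) (ℕP.*-comm (P ℕ.* P) collisions))))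
                     (vsum-const m (Q ℕ.* Q)) ⟩
    collisions ℕ.* (P ℕ.* P) ℕ.+ P ℕ.* (Q ℕ.* Q)
      ∎
    where
    open ≡-Reasoning
    P = p ^ m
    Q = p ^ N
    S = vsum m (λ t → deviation t ℕ.* deviation t)
    regroup₁ : ∀ x P Q → 2 ℕ.* P ℕ.* Q ℕ.* x ≡ 2 ℕ.* (x ℕ.* P ℕ.* Q)
    regroup₁ = ℕ-Solver.solve-∀
    regroup₂ : ∀ x P → x ℕ.* P ℕ.* (x ℕ.* P) ≡ P ℕ.* P ℕ.* (x ℕ.* x)
    regroup₂ = ℕ-Solver.solve-∀

  deviation-bound : ∀ t → deviation t ℕ.* deviation t ℕ.* p ^ r ≤ p ^ m ℕ.* p ^ m ℕ.* (p ^ N ℕ.* p ^ N) ℕ.* p ^ m₂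
  deviation-bound t = second-moment-arithmetic _ collisions _ (p ^ m) (p ^ N) (p ^ m₂) (p ^ r) Σdeviation²-identity collisions-bound
    (≤-vsum m (λ eq → cong (λ z → ∣ z ℕ.* p ^ m - p ^ N ∣ ℕ.* ∣ z ℕ.* p ^ m - p ^ N ∣) (vsum-cong N (λ x → 𝟙≟V-extensional (Φ x) eq))) t)

  probability-bound : ∀ v U V → (∀ i → Symmetric (U i)) → (∀ i → SkewSymmetric (V i)) →
    ((prob k n 𝔅 v U V - mainTerm k d₁ d₂ d₃) * (prob k n 𝔅 v U V - mainTerm k d₁ d₂ d₃)) * (+ (p ^ r) / 1) ≤ℚ + (p ^ m₂) / 1
  probability-bound v U V sU sV =
    squaredDeviation (List.length (List.filter (hits? 𝔅 v U V) (allMats k n))) (p ^ N) (p ^ e) (p ^ r) (p ^ m₂) {{m^n≢0 p N}} {{m^n≢0 p e}}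
      (subst₂ (λ a P → ∣ a ℕ.* P - p ^ N ∣ ℕ.* ∣ a ℕ.* P - p ^ N ∣ ℕ.* p ^ r ≤ P ℕ.* P ℕ.* (p ^ N ℕ.* p ^ N) ℕ.* p ^ m₂)
              (sym (hitCount≡fibre v U V sU sV)) (cong (p ^_) (sym (exponent≡ k d₁ d₂ d₃)))
              (deviation-bound (targetCoords v U V)))
    where
    e = k ℕ.* d₁ ℕ.+ (suc k C 2) ℕ.* d₂ ℕ.+ (k C 2) ℕ.* d₃

proposition4p2 : (p : ℕ) → .{{_ : NonZero p}} → Prime p → p ≢ 2 →
    (k d₁ d₂ d₃ : ℕ) → 1 ≤ k →
    Σ ℚ λ C →
      (n r : ℕ) → 1 ≤ n →
      (𝔅 : Fp.QFactor p n d₁ d₂ d₃) → Fp.FactorRankAtLeast p r 𝔅 →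
      (v : Fin d₁ → Fp.Vect p k) → (U : Fin d₂ → Fp.Mat p k k) → (V : Fin d₃ → Fp.Mat p k k) →
      ((i : Fin d₂) → Fp.Symmetric p (U i)) → ((i : Fin d₃) → Fp.SkewSymmetric p (V i)) →
      ((Fp.prob p k n 𝔅 v U V - Fp.mainTerm p k d₁ d₂ d₃) * (Fp.prob p k n 𝔅 v U V - Fp.mainTerm p k d₁ d₂ d₃)) * ((+ (p ^ r)) / 1) ≤ℚ C
proposition4p2 p p-prime p≢2 k d₁ d₂ d₃ _ =
  + (p ^ (d₂ ℕ.* triangle k ℕ.+ d₃ ℕ.* strictTriangle k)) / 1 ,
  λ n r _ 𝔅 hasRank → SecondMoment.probability-bound p p-prime p≢2 k 𝔅 r hasRank
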